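{- Let $0<q<1$, let $k,n$ be nonnegative integers and let $x\in[0,1]$. Then $$B_{k,n}(x,q)=\sum_{i=k}^{n}\binom{i}{k}\binom{n}{i}(-1)^{i-k}q^{(1-x)(i-k)}[x]_q^{i},$$ where an empty sum (when $k>n$) is $0$.
   Context: Let $q$ be a real number with $0<q<1$. For real $x$, the $q$-number is $[x]_q=\frac{1-q^x}{1-q}$. For a nonnegative integer $k$ and $x\in[0,1]$, the modified $q$-Bernstein polynomials $B_{k,n}(x,q)$, $n=0,1,2,\dots$, are defined by the generating function $$\frac{t^k e^{[1-x]_q t}[x]_q^k}{k!}=\sum_{n=0}^\infty B_{k,n}(x,q)\frac{t^n}{n!}.$$ -}

module Defs where

open import Algebra.Bundles using (CommutativeRing; Semiring)
import Algebra.Definitions.RawSemiring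
open import Data.Bool using (if_then_else_)
open import Data.Fin using (toℕ)
open import Data.Integer as ℤ using (+_; -[1+_])
import Data.Integer.Properties as ℤ
open import Data.Nat as ℕ using (ℕ; zero; suc; _∸_; _!)
import Data.Nat.Properties as ℕ
open import Data.Product using (∃; _×_; _,_; proj₁; proj₂)
open import Data.Rational as ℚ using (ℚ; 0ℚ; 1ℚ; ½; ∣_∣)
import Data.Rational.Properties as ℚ
open import Data.Rational.Solver using (module +-*-Solver)
import Data.Rational.Unnormalised as ℚᵘ
import Data.Rational.Unnormalised.Properties as ℚᵘ
open import Data.Sum using (inj₁; inj₂)
open import Level using (0ℓ)
open import Relation.Binary.PropositionalEquality using (_≡_; refl; sym; trans; cong; cong₂; subst; subst₂)
open import Relation.Nullary using (¬_; yes; no; contradiction)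

module RationalLemmas where
  open import Data.Rational
  open import Data.Rational.Properties
  open import Data.Rational.Solver
  open import Algebra.Definitions.RawSemiring +-*-rawSemiring public using (_^_)
  open ≤-Reasoning
  open +-*-Solver

  0≤1 : 0ℚ ≤ 1ℚ
  0≤1 = nonNegative⁻¹ 1ℚ

  *-nonneg : ∀ {p q} → 0ℚ ≤ p → 0ℚ ≤ q → 0ℚ ≤ p * q
  *-nonneg {p} {q} 0≤p 0≤q = begin
    0ℚ      ≡⟨ *-zeroˡ q ⟨
    0ℚ * q  ≤⟨ *-monoʳ-≤-nonNeg q ⦃ nonNegative 0≤q ⦄ 0≤p ⟩
    p * q   ∎

  *-pos : ∀ {p q} → 0ℚ < p → 0ℚ < q → 0ℚ < p * q
  *-pos {p} {q} 0<p 0<q = begin-strict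
    0ℚ      ≡⟨ *-zeroˡ q ⟨
    0ℚ * q  <⟨ *-monoˡ-<-pos q ⦃ positive 0<q ⦄ 0<p ⟩
    p * q   ∎

  *-mono-≤ : ∀ {p q r s} → 0ℚ ≤ p → 0ℚ ≤ s → p ≤ q → r ≤ s → p * r ≤ q * s
  *-mono-≤ {p} {q} {r} {s} 0≤p 0≤s p≤q r≤s =
    ≤-trans (*-monoˡ-≤-nonNeg p ⦃ nonNegative 0≤p ⦄ r≤s)
            (*-monoʳ-≤-nonNeg s ⦃ nonNegative 0≤s ⦄ p≤q)

  ≤⇒0≤- : ∀ {p q} → p ≤ q → 0ℚ ≤ q - p
  ≤⇒0≤- {p} {q} p≤q = begin
    0ℚ     ≡⟨ +-inverseʳ p ⟨
    p - p  ≤⟨ +-monoˡ-≤ (- p) p≤q ⟩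
    q - p  ∎

  <⇒0<- : ∀ {p q} → p < q → 0ℚ < q - p
  <⇒0<- {p} {q} p<q = begin-strict
    0ℚ     ≡⟨ +-inverseʳ p ⟨
    p - p  <⟨ +-monoˡ-< (- p) p<q ⟩
    q - p  ∎

  0≤-⇒≤ : ∀ {p q} → 0ℚ ≤ q - p → p ≤ q
  0≤-⇒≤ {p} {q} 0≤q-p = begin
    p            ≡⟨ +-identityʳ p ⟨
    p + 0ℚ       ≤⟨ +-monoʳ-≤ p 0≤q-p ⟩
    p + (q - p)  ≡⟨ solve 2 (λ p q → p :+ (q :- p) := q) refl p q ⟩
    q            ∎

  ∣-∣-sym : ∀ p q → ∣ p - q ∣ ≡ ∣ q - p ∣
  ∣-∣-sym p q = trans (cong ∣_∣ (solve 2 (λ p q → p :- q := :- (q :- p)) refl p q))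
                      (∣-p∣≡∣p∣ (q - p))

  ∣-∣-triangle : ∀ p q r → ∣ p - r ∣ ≤ ∣ p - q ∣ + ∣ q - r ∣
  ∣-∣-triangle p q r = begin
    ∣ p - r ∣              ≡⟨ cong ∣_∣ (solve 3 (λ p q r → p :- r := (p :- q) :+ (q :- r)) refl p q r) ⟩
    ∣ (p - q) + (q - r) ∣  ≤⟨ ∣p+q∣≤∣p∣+∣q∣ (p - q) (q - r) ⟩
    ∣ p - q ∣ + ∣ q - r ∣  ∎

  half+half : ∀ ε → ½ * ε + ½ * ε ≡ ε
  half+half ε = solve 1 (λ e → con ½ :* e :+ con ½ :* e := e) refl ε

  half-pos : ∀ {ε} → 0ℚ < ε → 0ℚ < ½ * ε
  half-pos = *-pos (positive⁻¹ ½)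

  inverse : ∀ p → 0ℚ < p → ∃ λ g → 0ℚ < g × g * p ≡ 1ℚ
  inverse p 0<p = 1/p , positive⁻¹ 1/p ⦃ 1/pos⇒pos p ⦄ , *-inverseˡ p
    where
    instance _ = positive 0<p
    instance _ = pos⇒nonZero p
    1/p = 1/ p

  scale : ∀ K → 0ℚ ≤ K → ∀ {ε} → 0ℚ < ε → ∃ λ δ → 0ℚ < δ × K * δ < ε
  scale K 0≤K {ε} 0<ε with inverse (K + 1ℚ) (+-mono-≤-< 0≤K (positive⁻¹ 1ℚ))
  ... | g , 0<g , eq = g * ε , *-pos 0<g 0<ε , (begin-strict
    K * (g * ε)             ≡⟨ +-identityʳ _ ⟨
    K * (g * ε) + 0ℚ        <⟨ +-monoʳ-< (K * (g * ε)) (*-pos 0<g 0<ε) ⟩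
    K * (g * ε) + g * ε     ≡⟨ solve 3 (λ K g e → K :* (g :* e) :+ g :* e := g :* (K :+ con 1ℚ) :* e) refl K g ε ⟩
    g * (K + 1ℚ) * ε        ≡⟨ cong (_* ε) eq ⟩
    1ℚ * ε                  ≡⟨ *-identityˡ ε ⟩
    ε                       ∎)

  ι : ℕ → ℚ
  ι n = + n / 1

  toℚᵘ-/ : ∀ i d → ℚᵘ._≃_ (toℚᵘ (i / suc d)) (ℚᵘ.mkℚᵘ i d)
  toℚᵘ-/ i d = toℚᵘ-fromℚᵘ (ℚᵘ.mkℚᵘ i d)

  ι-suc : ∀ n → ι (suc n) ≡ ι n + 1ℚ
  ι-suc n = toℚᵘ-injective (ℚᵘ.≃-trans (toℚᵘ-/ (+ suc n) 0) (ℚᵘ.≃-sym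
    (ℚᵘ.≃-trans (toℚᵘ-homo-+ (ι n) 1ℚ)
    (ℚᵘ.≃-trans (ℚᵘ.+-congˡ (toℚᵘ 1ℚ) (toℚᵘ-/ (+ n) 0))
    (ℚᵘ.*≡* (trans (ℤ.*-identityʳ _) (trans (cong (ℤ._+ + 1) (ℤ.*-identityʳ (+ n)))
      (trans (ℤ.+-comm (+ n) (+ 1)) (sym (ℤ.*-identityʳ (+ suc n)))))))))))

  ι-mono : ∀ {m n} → m ℕ.≤ n → ι m ≤ ι n
  ι-mono {m} {n} m≤n = toℚᵘ-cancel-≤
    (ℚᵘ.≤-respˡ-≃ (ℚᵘ.≃-sym (toℚᵘ-/ (+ m) 0)) (ℚᵘ.≤-respʳ-≃ (ℚᵘ.≃-sym (toℚᵘ-/ (+ n) 0))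
      (ℚᵘ.*≤* (ℤ.*-monoʳ-≤-nonNeg (+ 1) (ℤ.+≤+ m≤n)))))

  0≤ι : ∀ n → 0ℚ ≤ ι n
  0≤ι n = ι-mono {0} {n} ℕ.z≤n

  archimedean : ∀ p → ∃ λ n → p ≤ ι n
  archimedean p@(mkℚ i d _) = ℤ.∣ i ∣ , toℚᵘ-cancel-≤
    (ℚᵘ.≤-respʳ-≃ (ℚᵘ.≃-sym (toℚᵘ-/ (+ ℤ.∣ i ∣) 0))
      (ℚᵘ.*≤* (ℤ.≤-trans (ℤ.*-monoʳ-≤-nonNeg (+ 1) (i≤∣i∣ i))
        (ℤ.*-monoˡ-≤-nonNeg (+ ℤ.∣ i ∣) {+ 1} {+ suc d} (ℤ.+≤+ (ℕ.s≤s ℕ.z≤n))))))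
    where
    i≤∣i∣ : ∀ i → i ℤ.≤ + ℤ.∣ i ∣
    i≤∣i∣ (+ n)     = ℤ.≤-refl
    i≤∣i∣ -[1+ n ]  = ℤ.-≤+

  unitFraction-* : ∀ m n .⦃ _ : ℕ.NonZero m ⦄ .⦃ _ : ℕ.NonZero n ⦄ .⦃ _ : ℕ.NonZero (m ℕ.* n) ⦄ →
                   (+ 1 / (m ℕ.* n)) * ι m ≡ + 1 / n
  unitFraction-* (suc m) (suc n) = toℚᵘ-injective (ℚᵘ.≃-trans (toℚᵘ-homo-* (+ 1 / (suc m ℕ.* suc n)) (ι (suc m)))
    (ℚᵘ.≃-trans (ℚᵘ.*-cong (toℚᵘ-/ (+ 1) (n ℕ.+ m ℕ.* suc n)) (toℚᵘ-/ (+ suc m) 0))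
    (ℚᵘ.≃-trans (ℚᵘ.*≡* (cong +_ (lem)))
    (ℚᵘ.≃-sym (toℚᵘ-/ (+ 1) n)))))
    where
    lem : (suc m ℕ.+ 0) ℕ.* suc n ≡ suc (n ℕ.+ m ℕ.* suc n) ℕ.* 1 ℕ.+ 0
    lem = trans (cong (ℕ._* suc n) (ℕ.+-identityʳ (suc m))) (sym (trans (ℕ.+-identityʳ _) (ℕ.*-identityʳ _)))

  1/!_ : ℕ → ℚ
  1/! n = (+ 1 / n !) ⦃ n ℕ.!≢0 ⦄

  1/!-suc : ∀ n → (1/! suc n) * ι (suc n) ≡ 1/! n
  1/!-suc n = unitFraction-* (suc n) (n !) ⦃ _ ⦄ ⦃ n ℕ.!≢0 ⦄ ⦃ suc n ℕ.!≢0 ⦄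

  1/!-*-! : ∀ n → (1/! n) * ι (n !) ≡ 1ℚ
  1/!-*-! n = trans
    (cong (_* ι (n !)) (/-cong {+ 1} {n !} {+ 1} {n ! ℕ.* 1} ⦃ n ℕ.!≢0 ⦄ ⦃ n!1≢0 ⦄ refl (sym (ℕ.*-identityʳ (n !)))))
    (unitFraction-* (n !) 1 ⦃ n ℕ.!≢0 ⦄ ⦃ _ ⦄ ⦃ n!1≢0 ⦄)
    where
    n!1≢0 : ℕ.NonZero (n ! ℕ.* 1)
    n!1≢0 = subst ℕ.NonZero (sym (ℕ.*-identityʳ (n !))) (n ℕ.!≢0)

  1/!-nonneg : ∀ n → 0ℚ ≤ 1/! n
  1/!-nonneg n = nonNegative⁻¹ (1/! n) ⦃ normalize-nonNeg 1 (n !) ⦃ n ℕ.!≢0 ⦄ ⦄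

  ^-nonneg : ∀ {p} → 0ℚ ≤ p → ∀ n → 0ℚ ≤ p ^ n
  ^-nonneg 0≤p zero    = 0≤1
  ^-nonneg 0≤p (suc n) = *-nonneg 0≤p (^-nonneg 0≤p n)

  ∣^∣ : ∀ p n → ∣ p ^ n ∣ ≡ ∣ p ∣ ^ n
  ∣^∣ p zero    = refl
  ∣^∣ p (suc n) = trans (∣p*q∣≡∣p∣*∣q∣ p (p ^ n)) (cong (∣ p ∣ *_) (∣^∣ p n))

  ^-mono : ∀ {p q} → 0ℚ ≤ p → p ≤ q → ∀ n → p ^ n ≤ q ^ n
  ^-mono 0≤p p≤q zero    = ≤-refl
  ^-mono 0≤p p≤q (suc n) = *-mono-≤ 0≤p (^-nonneg (≤-trans 0≤p p≤q) n) p≤q (^-mono 0≤p p≤q n)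

  ∣∣≤⇒∣^∣≤ : ∀ {p r} → ∣ p ∣ ≤ r → ∀ n → ∣ p ^ n ∣ ≤ r ^ n
  ∣∣≤⇒∣^∣≤ {p} p≤r n = ≤-trans (≤-reflexive (∣^∣ p n)) (^-mono (0≤∣p∣ p) p≤r n)

  module Geometric {ρ : ℚ} (0≤ρ : 0ℚ ≤ ρ) (ρ<1 : ρ < 1ℚ) where

    ^-anti : ∀ d n → ρ ^ (d ℕ.+ n) ≤ ρ ^ n
    ^-anti zero    n = ≤-refl
    ^-anti (suc d) n = begin
      ρ * ρ ^ (d ℕ.+ n)  ≤⟨ *-mono-≤ 0≤ρ (^-nonneg 0≤ρ n) (<⇒≤ ρ<1) (^-anti d n) ⟩
      1ℚ * ρ ^ n         ≡⟨ *-identityˡ _ ⟩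
      ρ ^ n              ∎

    ^≤1 : ∀ n → ρ ^ n ≤ 1ℚ
    ^≤1 n = subst (λ m → ρ ^ m ≤ 1ℚ) (ℕ.+-identityʳ n) (^-anti n 0)

    bernoulli : ∀ n → ι n * ρ ^ n * (1ℚ - ρ) ≤ 1ℚ - ρ ^ n
    bernoulli zero    = ≤-reflexive (solve 1 (λ r → con 0ℚ :* con 1ℚ :* (con 1ℚ :- r) := con 0ℚ) refl ρ)
    bernoulli (suc n) = begin
      ι (suc n) * (ρ * ρ ^ n) * (1ℚ - ρ)
        ≡⟨ cong (λ z → z * (ρ * ρ ^ n) * (1ℚ - ρ)) (ι-suc n) ⟩
      (ι n + 1ℚ) * (ρ * ρ ^ n) * (1ℚ - ρ)
        ≡⟨ solve 3 (λ i r p → (i :+ con 1ℚ) :* (r :* p) :* (con 1ℚ :- r)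
             := r :* (i :* p :* (con 1ℚ :- r)) :+ r :* p :* (con 1ℚ :- r)) refl (ι n) ρ (ρ ^ n) ⟩
      ρ * (ι n * ρ ^ n * (1ℚ - ρ)) + ρ * ρ ^ n * (1ℚ - ρ)
        ≤⟨ +-monoˡ-≤ _ (*-monoˡ-≤-nonNeg ρ ⦃ nonNegative 0≤ρ ⦄ (bernoulli n)) ⟩
      ρ * (1ℚ - ρ ^ n) + ρ * ρ ^ n * (1ℚ - ρ)
        ≤⟨ 0≤-⇒≤ (≤-trans (*-nonneg (≤⇒0≤- (<⇒≤ ρ<1)) (≤⇒0≤- (^≤1 (suc n))))
             (≤-reflexive (solve 2 (λ r p → (con 1ℚ :- r) :* (con 1ℚ :- r :* p) :=
               (con 1ℚ :- r :* p) :- (r :* (con 1ℚ :- p) :+ r :* p :* (con 1ℚ :- r))) refl ρ (ρ ^ n)))) ⟩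
      1ℚ - ρ * ρ ^ n ∎

    gap : ∃ λ g → 0ℚ < g × g * (1ℚ - ρ) ≡ 1ℚ
    gap = inverse (1ℚ - ρ) (<⇒0<- ρ<1)

    g : ℚ
    g = proj₁ gap

    0≤g : 0ℚ ≤ g
    0≤g = <⇒≤ (proj₁ (proj₂ gap))

    g[1-ρ]≡1 : g * (1ℚ - ρ) ≡ 1ℚ
    g[1-ρ]≡1 = proj₂ (proj₂ gap)

    ιρ^≤g : ∀ n → ι n * ρ ^ n ≤ g
    ιρ^≤g n = begin
      ι n * ρ ^ n                       ≡⟨ *-identityˡ _ ⟨
      1ℚ * (ι n * ρ ^ n)                ≡⟨ cong (_* (ι n * ρ ^ n)) g[1-ρ]≡1 ⟨
      g * (1ℚ - ρ) * (ι n * ρ ^ n)      ≡⟨ solve 3 (λ g d t → g :* d :* t := g :* (t :* d)) refl g (1ℚ - ρ) (ι n * ρ ^ n) ⟩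
      g * (ι n * ρ ^ n * (1ℚ - ρ))      ≤⟨ *-monoˡ-≤-nonNeg g ⦃ nonNegative 0≤g ⦄ (bernoulli n) ⟩
      g * (1ℚ - ρ ^ n)                  ≤⟨ *-monoˡ-≤-nonNeg g ⦃ nonNegative 0≤g ⦄
                                             (0≤-⇒≤ (≤-trans (^-nonneg 0≤ρ n) (≤-reflexive
                                               (solve 1 (λ p → p := con 1ℚ :- (con 1ℚ :- p)) refl (ρ ^ n))))) ⟩
      g * 1ℚ                            ≡⟨ *-identityʳ g ⟩
      g                                 ∎

    decay : ∀ K → 0ℚ ≤ K → ∀ {ε} → 0ℚ < ε → ∃ λ N → ∀ n → N ℕ.≤ n → K * ρ ^ n < ε
    decay K 0≤K {ε} 0<ε with inverse ε 0<ε
    ... | e , 0<e , eq with archimedean ((K * g + 1ℚ) * e)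
    ...   | N , le = N , λ n N≤n → *-cancelˡ-<-nonNeg (ι N) ⦃ nonNegative (0≤ι N) ⦄ (begin-strict
      ι N * (K * ρ ^ n)      ≤⟨ *-monoˡ-≤-nonNeg (ι N) ⦃ nonNegative (0≤ι N) ⦄
                                  (*-monoˡ-≤-nonNeg K ⦃ nonNegative 0≤K ⦄
                                    (subst (λ m → ρ ^ m ≤ ρ ^ N) (ℕ.m∸n+n≡m N≤n) (^-anti (n ℕ.∸ N) N))) ⟩
      ι N * (K * ρ ^ N)      ≡⟨ solve 3 (λ i K p → i :* (K :* p) := K :* (i :* p)) refl (ι N) K (ρ ^ N) ⟩
      K * (ι N * ρ ^ N)      ≤⟨ *-monoˡ-≤-nonNeg K ⦃ nonNegative 0≤K ⦄ (ιρ^≤g N) ⟩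
      K * g                  ≡⟨ +-identityʳ _ ⟨
      K * g + 0ℚ             <⟨ +-monoʳ-< (K * g) (positive⁻¹ 1ℚ) ⟩
      K * g + 1ℚ             ≡⟨ *-identityʳ _ ⟨
      (K * g + 1ℚ) * 1ℚ      ≡⟨ cong ((K * g + 1ℚ) *_) eq ⟨
      (K * g + 1ℚ) * (e * ε) ≡⟨ *-assoc (K * g + 1ℚ) e ε ⟨
      (K * g + 1ℚ) * e * ε   ≤⟨ *-monoʳ-≤-nonNeg ε ⦃ nonNegative (<⇒≤ 0<ε) ⦄ le ⟩
      ι N * ε                ∎)

  partialSum : (ℕ → ℚ) → ℕ → ℚ
  partialSum t zero    = 0ℚ
  partialSum t (suc n) = partialSum t n + t n

  partialSum-member : ∀ {t} → (∀ j → 0ℚ ≤ t j) → ∀ {j n} → j ℕ.< n → t j ≤ partialSum t n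
  partialSum-member {t} 0≤t {j} {suc n} (ℕ.s≤s j≤n) with ℕ.m≤n⇒m<n∨m≡n j≤n
  ... | inj₁ j<n  = begin
    t j                   ≡⟨ +-identityʳ _ ⟨
    t j + 0ℚ              ≤⟨ +-mono-≤ (partialSum-member 0≤t j<n) (0≤t n) ⟩
    partialSum t n + t n  ∎
  ... | inj₂ refl = begin
    t j                   ≡⟨ +-identityˡ _ ⟨
    0ℚ + t j              ≤⟨ +-monoˡ-≤ (t j) (nonneg n) ⟩
    partialSum t n + t n  ∎
    where
    nonneg : ∀ n → 0ℚ ≤ partialSum t n
    nonneg zero    = ≤-refl
    nonneg (suc n) = +-mono-≤ (nonneg n) (0≤t n)

  eval : (ℕ → ℚ) → ℕ → ℚ → ℚ
  eval a n y = partialSum (λ j → a j * y ^ j) n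

  ^-lipschitz : ∀ {y z r} → ∣ y ∣ ≤ r → ∣ z ∣ ≤ r → ∀ j →
                ∣ y ^ suc j - z ^ suc j ∣ ≤ ι (suc j) * r ^ j * ∣ y - z ∣
  ^-lipschitz {y} {z} y≤r z≤r zero = ≤-reflexive (trans
    (cong ∣_∣ (solve 2 (λ y z → y :* con 1ℚ :- z :* con 1ℚ := y :- z) refl y z))
    (solve 1 (λ d → d := con 1ℚ :* con 1ℚ :* d) refl ∣ y - z ∣))
  ^-lipschitz {y} {z} {r} y≤r z≤r (suc j) = begin
    ∣ y * Y - z * Z ∣
      ≡⟨ cong ∣_∣ (solve 4 (λ y z Y Z → y :* Y :- z :* Z := y :* (Y :- Z) :+ (y :- z) :* Z) refl y z Y Z) ⟩
    ∣ y * (Y - Z) + (y - z) * Z ∣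
      ≤⟨ ∣p+q∣≤∣p∣+∣q∣ (y * (Y - Z)) ((y - z) * Z) ⟩
    ∣ y * (Y - Z) ∣ + ∣ (y - z) * Z ∣
      ≡⟨ cong₂ _+_ (∣p*q∣≡∣p∣*∣q∣ y (Y - Z)) (∣p*q∣≡∣p∣*∣q∣ (y - z) Z) ⟩
    ∣ y ∣ * ∣ Y - Z ∣ + ∣ y - z ∣ * ∣ Z ∣
      ≤⟨ +-mono-≤ (*-mono-≤ (0≤∣p∣ y) (≤-trans (0≤∣p∣ (Y - Z)) ih) y≤r ih)
                  (*-monoˡ-≤-nonNeg ∣ y - z ∣ ⦃ ∣-∣-nonNeg (y - z) ⦄ (∣∣≤⇒∣^∣≤ {z} z≤r (suc j))) ⟩
    r * (ι (suc j) * r ^ j * ∣ y - z ∣) + ∣ y - z ∣ * (r * r ^ j)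
      ≡⟨ solve 4 (λ r i p d → r :* (i :* p :* d) :+ d :* (r :* p) := (i :+ con 1ℚ) :* (r :* p) :* d)
           refl r (ι (suc j)) (r ^ j) ∣ y - z ∣ ⟩
    (ι (suc j) + 1ℚ) * (r * r ^ j) * ∣ y - z ∣
      ≡⟨ cong (λ i → i * (r * r ^ j) * ∣ y - z ∣) (ι-suc (suc j)) ⟨
    ι (suc (suc j)) * (r * r ^ j) * ∣ y - z ∣ ∎
    where
    Y Z : ℚ
    Y = y ^ suc j
    Z = z ^ suc j
    ih : ∣ Y - Z ∣ ≤ ι (suc j) * r ^ j * ∣ y - z ∣
    ih = ^-lipschitz {y} {z} y≤r z≤r j

  -- bound′ controls the formally differentiated series, hence Lipschitz continuity.
  record GeometricBound (a : ℕ → ℚ) (r : ℚ) : Set where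
    field
      C ρ   : ℚ
      0≤C   : 0ℚ ≤ C
      0≤ρ   : 0ℚ ≤ ρ
      ρ<1   : ρ < 1ℚ
      bound  : ∀ j → ∣ a j ∣ * r ^ j ≤ C * ρ ^ j
      bound′ : ∀ j → ∣ a (suc j) ∣ * r ^ j ≤ C * ρ ^ j

    open Geometric 0≤ρ ρ<1

    0≤Cg : 0ℚ ≤ C * g
    0≤Cg = *-nonneg 0≤C 0≤g

    Cg[1-ρ]≡C : C * g * (1ℚ - ρ) ≡ C
    Cg[1-ρ]≡C = trans (*-assoc C g _) (trans (cong (C *_) g[1-ρ]≡1) (*-identityʳ C))

    eval-step : ∀ {y} → ∣ y ∣ ≤ r → ∀ d n →
                ∣ eval a (d ℕ.+ n) y - eval a n y ∣ ≤ C * g * ρ ^ n - C * g * ρ ^ (d ℕ.+ n)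
    eval-step {y} y≤r zero n = ≤-reflexive (trans (cong ∣_∣ (+-inverseʳ (eval a n y)))
                                                 (sym (+-inverseʳ (C * g * ρ ^ n))))
    eval-step {y} y≤r (suc d) n = begin
      ∣ S + t - s ∣
        ≡⟨ cong ∣_∣ (solve 3 (λ S t s → S :+ t :- s := (S :- s) :+ t) refl S t s) ⟩
      ∣ (S - s) + t ∣
        ≤⟨ ∣p+q∣≤∣p∣+∣q∣ (S - s) t ⟩
      ∣ S - s ∣ + ∣ t ∣
        ≤⟨ +-mono-≤ (eval-step {y} y≤r d n) t≤ ⟩
      (C * g * ρ ^ n - C * g * ρ ^ m) + C * ρ ^ m
        ≡⟨ cong (λ c → (C * g * ρ ^ n - C * g * ρ ^ m) + c * ρ ^ m) Cg[1-ρ]≡C ⟨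
      (C * g * ρ ^ n - C * g * ρ ^ m) + C * g * (1ℚ - ρ) * ρ ^ m
        ≡⟨ solve 4 (λ G p q r → (G :* p :- G :* q) :+ G :* (con 1ℚ :- r) :* q := G :* p :- G :* (r :* q))
             refl (C * g) (ρ ^ n) (ρ ^ m) ρ ⟩
      C * g * ρ ^ n - C * g * (ρ * ρ ^ m) ∎
      where
      m : ℕ
      m = d ℕ.+ n
      S s t : ℚ
      S = eval a m y
      s = eval a n y
      t = a m * y ^ m
      t≤ : ∣ t ∣ ≤ C * ρ ^ m
      t≤ = begin
        ∣ t ∣                    ≡⟨ ∣p*q∣≡∣p∣*∣q∣ (a m) (y ^ m) ⟩
        ∣ a m ∣ * ∣ y ^ m ∣      ≤⟨ *-monoˡ-≤-nonNeg ∣ a m ∣ ⦃ ∣-∣-nonNeg (a m) ⦄ (∣∣≤⇒∣^∣≤ {y} y≤r m) ⟩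
        ∣ a m ∣ * r ^ m          ≤⟨ bound m ⟩
        C * ρ ^ m                ∎

    eval-tail : ∀ {y} → ∣ y ∣ ≤ r → ∀ {m n} → n ℕ.≤ m →
                ∣ eval a m y - eval a n y ∣ ≤ C * g * ρ ^ n
    eval-tail {y} y≤r {m} {n} n≤m =
      subst (λ l → ∣ eval a l y - eval a n y ∣ ≤ C * g * ρ ^ n) (ℕ.m∸n+n≡m n≤m) (begin
        ∣ eval a (m ℕ.∸ n ℕ.+ n) y - eval a n y ∣
          ≤⟨ eval-step {y} y≤r (m ℕ.∸ n) n ⟩
        C * g * ρ ^ n - C * g * ρ ^ (m ℕ.∸ n ℕ.+ n)
          ≤⟨ +-monoʳ-≤ (C * g * ρ ^ n) (neg-antimono-≤ (*-nonneg 0≤Cg (^-nonneg 0≤ρ (m ℕ.∸ n ℕ.+ n)))) ⟩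
        C * g * ρ ^ n - 0ℚ
          ≡⟨ +-identityʳ _ ⟩
        C * g * ρ ^ n ∎)

    W : ℕ → ℚ
    W = partialSum (λ j → ι (suc j) * ρ ^ j)

    W-closed : ∀ n → W n * ((1ℚ - ρ) * (1ℚ - ρ)) ≡ 1ℚ - ρ ^ n - ι n * ρ ^ n * (1ℚ - ρ)
    W-closed zero    = solve 1 (λ r → con 0ℚ :* ((con 1ℚ :- r) :* (con 1ℚ :- r))
                         := con 1ℚ :- con 1ℚ :- con 0ℚ :* con 1ℚ :* (con 1ℚ :- r)) refl ρ
    W-closed (suc n) rewrite ι-suc n = trans
      (*-distribʳ-+ ((1ℚ - ρ) * (1ℚ - ρ)) (W n) ((ι n + 1ℚ) * ρ ^ n))
      (trans (cong (_+ ((ι n + 1ℚ) * ρ ^ n) * ((1ℚ - ρ) * (1ℚ - ρ))) (W-closed n))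
        (solve 3 (λ r p i → (con 1ℚ :- p :- i :* p :* (con 1ℚ :- r))
              :+ ((i :+ con 1ℚ) :* p) :* ((con 1ℚ :- r) :* (con 1ℚ :- r))
           := con 1ℚ :- r :* p :- (i :+ con 1ℚ) :* (r :* p) :* (con 1ℚ :- r)) refl ρ (ρ ^ n) (ι n)))

    W≤ : ∀ n → W n ≤ g * g
    W≤ n = begin
      W n                                          ≡⟨ *-identityˡ _ ⟨
      1ℚ * W n                                     ≡⟨ cong (_* W n) (cong₂ _*_ g[1-ρ]≡1 g[1-ρ]≡1) ⟨
      g * (1ℚ - ρ) * (g * (1ℚ - ρ)) * W n          ≡⟨ solve 3 (λ g d w → g :* d :* (g :* d) :* w := g :* g :* (w :* (d :* d)))
                                                        refl g (1ℚ - ρ) (W n) ⟩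
      g * g * (W n * ((1ℚ - ρ) * (1ℚ - ρ)))        ≡⟨ cong (g * g *_) (W-closed n) ⟩
      g * g * (1ℚ - ρ ^ n - ι n * ρ ^ n * (1ℚ - ρ)) ≤⟨ *-monoˡ-≤-nonNeg (g * g) ⦃ nonNegative (*-nonneg 0≤g 0≤g) ⦄
                                                        (0≤-⇒≤ (≤-trans (+-mono-≤ (^-nonneg 0≤ρ n)
                                                           (*-nonneg (*-nonneg (0≤ι n) (^-nonneg 0≤ρ n)) (≤⇒0≤- (<⇒≤ ρ<1))))
                                                          (≤-reflexive (solve 2 (λ p q → p :+ q := con 1ℚ :- (con 1ℚ :- p :- q))
                                                             refl (ρ ^ n) (ι n * ρ ^ n * (1ℚ - ρ)))))) ⟩
      g * g * 1ℚ                                   ≡⟨ *-identityʳ _ ⟩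
      g * g                                        ∎

    eval-lipschitz-W : ∀ {y z} → ∣ y ∣ ≤ r → ∣ z ∣ ≤ r → ∀ n →
                       ∣ eval a (suc n) y - eval a (suc n) z ∣ ≤ C * W n * ∣ y - z ∣
    eval-lipschitz-W {y} {z} y≤r z≤r zero = ≤-reflexive (trans
      (cong ∣_∣ (+-inverseʳ (0ℚ + a 0 * 1ℚ)))
      (solve 2 (λ c d → con 0ℚ := c :* con 0ℚ :* d) refl C ∣ y - z ∣))
    eval-lipschitz-W {y} {z} y≤r z≤r (suc n) = begin
      ∣ S + A * Y - (s + A * Z) ∣
        ≡⟨ cong ∣_∣ (solve 5 (λ S s A Y Z → S :+ A :* Y :- (s :+ A :* Z) := (S :- s) :+ A :* (Y :- Z)) refl S s A Y Z) ⟩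
      ∣ (S - s) + A * (Y - Z) ∣
        ≤⟨ ∣p+q∣≤∣p∣+∣q∣ (S - s) (A * (Y - Z)) ⟩
      ∣ S - s ∣ + ∣ A * (Y - Z) ∣
        ≤⟨ +-mono-≤ (eval-lipschitz-W {y} {z} y≤r z≤r n) last≤ ⟩
      C * W n * ∣ y - z ∣ + C * ρ ^ n * (ι (suc n) * ∣ y - z ∣)
        ≡⟨ solve 5 (λ C w d p i → C :* w :* d :+ C :* p :* (i :* d) := C :* (w :+ i :* p) :* d)
             refl C (W n) ∣ y - z ∣ (ρ ^ n) (ι (suc n)) ⟩
      C * W (suc n) * ∣ y - z ∣ ∎
      where
      S s A Y Z : ℚ
      S = eval a (suc n) y
      s = eval a (suc n) z
      A = a (suc n)
      Y = y ^ suc n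
      Z = z ^ suc n
      last≤ : ∣ A * (Y - Z) ∣ ≤ C * ρ ^ n * (ι (suc n) * ∣ y - z ∣)
      last≤ = begin
        ∣ A * (Y - Z) ∣                             ≡⟨ ∣p*q∣≡∣p∣*∣q∣ A (Y - Z) ⟩
        ∣ A ∣ * ∣ Y - Z ∣                           ≤⟨ *-monoˡ-≤-nonNeg ∣ A ∣ ⦃ ∣-∣-nonNeg A ⦄ (^-lipschitz {y} {z} y≤r z≤r n) ⟩
        ∣ A ∣ * (ι (suc n) * r ^ n * ∣ y - z ∣)     ≡⟨ solve 4 (λ A i p d → A :* (i :* p :* d) := A :* p :* (i :* d))
                                                        refl (∣ A ∣) (ι (suc n)) (r ^ n) (∣ y - z ∣) ⟩
        ∣ A ∣ * r ^ n * (ι (suc n) * ∣ y - z ∣)     ≤⟨ *-monoʳ-≤-nonNeg (ι (suc n) * ∣ y - z ∣)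
                                                        ⦃ nonNegative (*-nonneg (0≤ι (suc n)) (0≤∣p∣ (y - z))) ⦄ (bound′ n) ⟩
        C * ρ ^ n * (ι (suc n) * ∣ y - z ∣)         ∎

    L : ℚ
    L = C * (g * g)

    0≤L : 0ℚ ≤ L
    0≤L = *-nonneg 0≤C (*-nonneg 0≤g 0≤g)

    eval-lipschitz : ∀ {y z} → ∣ y ∣ ≤ r → ∣ z ∣ ≤ r → ∀ n →
                     ∣ eval a n y - eval a n z ∣ ≤ L * ∣ y - z ∣
    eval-lipschitz {y} {z} y≤r z≤r zero = *-nonneg 0≤L (0≤∣p∣ (y - z))
    eval-lipschitz {y} {z} y≤r z≤r (suc n) = ≤-trans (eval-lipschitz-W {y} {z} y≤r z≤r n)
      (*-monoʳ-≤-nonNeg ∣ y - z ∣ ⦃ ∣-∣-nonNeg (y - z) ⦄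
        (*-monoˡ-≤-nonNeg C ⦃ nonNegative 0≤C ⦄ (W≤ n)))

  1/!-decreasing : ∀ j → 1/! suc j ≤ 1/! j
  1/!-decreasing j = begin
    1/! suc j                   ≡⟨ *-identityʳ _ ⟨
    (1/! suc j) * 1ℚ            ≤⟨ *-monoˡ-≤-nonNeg (1/! suc j) ⦃ nonNegative (1/!-nonneg (suc j)) ⦄
                                     (ι-mono {1} {suc j} (ℕ.s≤s ℕ.z≤n)) ⟩
    (1/! suc j) * ι (suc j)     ≡⟨ 1/!-suc j ⟩
    1/! j                       ∎

  ^-distrib-* : ∀ p q n → (p * q) ^ n ≡ p ^ n * q ^ n
  ^-distrib-* p q zero    = refl
  ^-distrib-* p q (suc n) = trans (cong (p * q *_) (^-distrib-* p q n))
    (solve 4 (λ p q P Q → p :* q :* (P :* Q) := p :* P :* (q :* Q)) refl p q (p ^ n) (q ^ n))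

  expBound : ∀ r → 0ℚ ≤ r → GeometricBound 1/!_ r
  expBound r 0≤r = record
    { C = C ; ρ = ½
    ; 0≤C = ≤-trans (0≤t 0) (t≤C 0)
    ; 0≤ρ = nonNegative⁻¹ ½
    ; ρ<1 = *<* (ℤ.+<+ (ℕ.s≤s (ℕ.s≤s ℕ.z≤n)))
    ; bound = bound
    ; bound′ = λ j → ≤-trans (*-monoʳ-≤-nonNeg (r ^ j) ⦃ nonNegative (^-nonneg 0≤r j) ⦄
        (subst₂ _≤_ (sym (0≤p⇒∣p∣≡p (1/!-nonneg (suc j)))) (sym (0≤p⇒∣p∣≡p (1/!-nonneg j)))
          (1/!-decreasing j))) (bound j)
    }
    where
    s : ℚ
    s = (1ℚ + 1ℚ) * r
    0≤s : 0ℚ ≤ s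
    0≤s = *-nonneg (nonNegative⁻¹ (1ℚ + 1ℚ)) 0≤r
    t : ℕ → ℚ
    t j = (1/! j) * s ^ j
    0≤t : ∀ j → 0ℚ ≤ t j
    0≤t j = *-nonneg (1/!-nonneg j) (^-nonneg 0≤s j)
    K : ℕ
    K = proj₁ (archimedean s)
    C : ℚ
    C = partialSum t (suc K)
    t-decreasing : ∀ j → K ℕ.≤ suc j → t (suc j) ≤ t j
    t-decreasing j K≤ = begin
      (1/! suc j) * (s * s ^ j)          ≡⟨ *-assoc (1/! suc j) s (s ^ j) ⟨
      (1/! suc j) * s * s ^ j            ≤⟨ *-monoʳ-≤-nonNeg (s ^ j) ⦃ nonNegative (^-nonneg 0≤s j) ⦄
                                             (*-monoˡ-≤-nonNeg (1/! suc j) ⦃ nonNegative (1/!-nonneg (suc j)) ⦄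
                                               (≤-trans (proj₂ (archimedean s)) (ι-mono K≤))) ⟩
      (1/! suc j) * ι (suc j) * s ^ j    ≡⟨ cong (_* s ^ j) (1/!-suc j) ⟩
      (1/! j) * s ^ j                    ∎
    t≤C : ∀ j → t j ≤ C
    t≤C zero    = partialSum-member 0≤t {0} {suc K} (ℕ.s≤s ℕ.z≤n)
    t≤C (suc j) with ℕ.≤-total K (suc j)
    ... | inj₁ K≤ = ≤-trans (t-decreasing j K≤) (t≤C j)
    ... | inj₂ ≤K = partialSum-member 0≤t {suc j} {suc K} (ℕ.s≤s ≤K)
    bound : ∀ j → ∣ 1/! j ∣ * r ^ j ≤ C * ½ ^ j
    bound j = begin
      ∣ 1/! j ∣ * r ^ j               ≡⟨ cong (_* r ^ j) (0≤p⇒∣p∣≡p (1/!-nonneg j)) ⟩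
      (1/! j) * r ^ j                 ≡⟨ cong (λ z → (1/! j) * z ^ j)
                                          (solve 1 (λ r → r := (con 1ℚ :+ con 1ℚ) :* r :* con ½) refl r) ⟩
      (1/! j) * (s * ½) ^ j           ≡⟨ cong ((1/! j) *_) (^-distrib-* s ½ j) ⟩
      (1/! j) * (s ^ j * ½ ^ j)       ≡⟨ *-assoc (1/! j) (s ^ j) (½ ^ j) ⟨
      t j * ½ ^ j                     ≤⟨ *-monoʳ-≤-nonNeg (½ ^ j) ⦃ nonNegative (^-nonneg (nonNegative⁻¹ ½) j) ⦄ (t≤C j) ⟩
      C * ½ ^ j                       ∎

  mercator : ℕ → ℚ
  mercator zero    = 0ℚ
  mercator (suc j) = + 1 / suc j

  mercator≤1 : ∀ j → ∣ mercator j ∣ ≤ 1ℚ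
  mercator≤1 zero    = 0≤1
  mercator≤1 (suc j) = begin
    ∣ p ∣          ≡⟨ 0≤p⇒∣p∣≡p 0≤p ⟩
    p              ≡⟨ *-identityʳ p ⟨
    p * 1ℚ         ≤⟨ *-monoˡ-≤-nonNeg p ⦃ nonNegative 0≤p ⦄ (ι-mono {1} {suc j} (ℕ.s≤s ℕ.z≤n)) ⟩
    p * ι (suc j)  ≡⟨ cong (_* ι (suc j)) (/-cong {+ 1} {suc j} {+ 1} {suc j ℕ.* 1} refl (sym (ℕ.*-identityʳ (suc j)))) ⟩
    (+ 1 / (suc j ℕ.* 1)) * ι (suc j)  ≡⟨ unitFraction-* (suc j) 1 ⟩
    1ℚ             ∎
    where
    p : ℚ
    p = + 1 / suc j
    0≤p : 0ℚ ≤ p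
    0≤p = nonNegative⁻¹ p ⦃ normalize-nonNeg 1 (suc j) ⦄

  mercatorBound : ∀ r → 0ℚ ≤ r → r < 1ℚ → GeometricBound mercator r
  mercatorBound r 0≤r r<1 = record
    { C = 1ℚ ; ρ = r ; 0≤C = 0≤1 ; 0≤ρ = 0≤r ; ρ<1 = r<1
    ; bound  = λ j → *-monoʳ-≤-nonNeg (r ^ j) ⦃ nonNegative (^-nonneg 0≤r j) ⦄ (mercator≤1 j)
    ; bound′ = λ j → *-monoʳ-≤-nonNeg (r ^ j) ⦃ nonNegative (^-nonneg 0≤r j) ⦄ (mercator≤1 (suc j))
    }

open RationalLemmas hiding (_^_)
open +-*-Solver using (solve; con; _:+_; _:*_; _:-_; :-_; _:=_)
open ℚ.≤-Reasoning

IsCauchy : (ℕ → ℚ) → Set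
IsCauchy s = ∀ {ε} → 0ℚ ℚ.< ε → ∃ λ N → ∀ {m n} → N ℕ.≤ m → N ℕ.≤ n → ∣ s m ℚ.- s n ∣ ℚ.< ε

-- Cantor's construction: reals are Cauchy sequences of rationals, and equality of
-- reals is the setoid relation _≈_.
record ℝ : Set where
  field
    seq    : ℕ → ℚ
    cauchy : IsCauchy seq

open ℝ public

infix 4 _≈_ _<_ _≤_

_≈_ : ℝ → ℝ → Set
x ≈ y = ∀ {ε} → 0ℚ ℚ.< ε → ∃ λ N → ∀ {n} → N ℕ.≤ n → ∣ seq x n ℚ.- seq y n ∣ ℚ.< ε

_<_ : ℝ → ℝ → Set
x < y = ∃ λ δ → 0ℚ ℚ.< δ × ∃ λ N → ∀ {n} → N ℕ.≤ n → seq x n ℚ.+ δ ℚ.≤ seq y n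

_≤_ : ℝ → ℝ → Set
x ≤ y = ¬ (y < x)

⊔ˡ : ∀ {m n o} → m ℕ.⊔ n ℕ.≤ o → m ℕ.≤ o
⊔ˡ {m} {n} = ℕ.≤-trans (ℕ.m≤m⊔n m n)

⊔ʳ : ∀ {m n o} → m ℕ.⊔ n ℕ.≤ o → n ℕ.≤ o
⊔ʳ {m} {n} = ℕ.≤-trans (ℕ.m≤n⊔m m n)

pointwise : ∀ {x y} → (∀ n → seq x n ≡ seq y n) → x ≈ y
pointwise {x} {y} eq {ε} 0<ε = 0 , λ {n} _ → begin-strict
  ∣ seq x n ℚ.- seq y n ∣  ≡⟨ cong (λ z → ∣ z ℚ.- seq y n ∣) (eq n) ⟩
  ∣ seq y n ℚ.- seq y n ∣  ≡⟨ cong ∣_∣ (ℚ.+-inverseʳ (seq y n)) ⟩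
  0ℚ                       <⟨ 0<ε ⟩
  ε                        ∎

∣+-+∣ : ∀ {ε} a b c d → ∣ a ℚ.- b ∣ ℚ.< ½ ℚ.* ε → ∣ c ℚ.- d ∣ ℚ.< ½ ℚ.* ε →
        ∣ (a ℚ.+ c) ℚ.- (b ℚ.+ d) ∣ ℚ.< ε
∣+-+∣ {ε} a b c d p q = begin-strict
  ∣ (a ℚ.+ c) ℚ.- (b ℚ.+ d) ∣         ≡⟨ cong ∣_∣ (solve 4 (λ a b c d → (a :+ c) :- (b :+ d) := (a :- b) :+ (c :- d)) refl a b c d) ⟩
  ∣ (a ℚ.- b) ℚ.+ (c ℚ.- d) ∣         ≤⟨ ℚ.∣p+q∣≤∣p∣+∣q∣ (a ℚ.- b) (c ℚ.- d) ⟩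
  ∣ a ℚ.- b ∣ ℚ.+ ∣ c ℚ.- d ∣         <⟨ ℚ.+-mono-< p q ⟩
  ½ ℚ.* ε ℚ.+ ½ ℚ.* ε                 ≡⟨ half+half ε ⟩
  ε                                   ∎

∣neg-neg∣ : ∀ a b → ∣ ℚ.- a ℚ.- ℚ.- b ∣ ≡ ∣ a ℚ.- b ∣
∣neg-neg∣ a b = trans (cong ∣_∣ (solve 2 (λ a b → :- a :- :- b := :- (a :- b)) refl a b)) (ℚ.∣-p∣≡∣p∣ (a ℚ.- b))

∣*-*∣ : ∀ {ε δ K M} a b c d → ∣ a ∣ ℚ.≤ K → ∣ d ∣ ℚ.≤ M → (K ℚ.+ M) ℚ.* δ ℚ.< ε →
        ∣ a ℚ.- b ∣ ℚ.< δ → ∣ c ℚ.- d ∣ ℚ.< δ → ∣ a ℚ.* c ℚ.- b ℚ.* d ∣ ℚ.< ε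
∣*-*∣ {ε} {δ} {K} {M} a b c d a≤K d≤M small p q = begin-strict
  ∣ a ℚ.* c ℚ.- b ℚ.* d ∣
    ≡⟨ cong ∣_∣ (solve 4 (λ a b c d → a :* c :- b :* d := a :* (c :- d) :+ d :* (a :- b)) refl a b c d) ⟩
  ∣ a ℚ.* (c ℚ.- d) ℚ.+ d ℚ.* (a ℚ.- b) ∣
    ≤⟨ ℚ.∣p+q∣≤∣p∣+∣q∣ (a ℚ.* (c ℚ.- d)) (d ℚ.* (a ℚ.- b)) ⟩
  ∣ a ℚ.* (c ℚ.- d) ∣ ℚ.+ ∣ d ℚ.* (a ℚ.- b) ∣
    ≡⟨ cong₂ ℚ._+_ (ℚ.∣p*q∣≡∣p∣*∣q∣ a (c ℚ.- d)) (ℚ.∣p*q∣≡∣p∣*∣q∣ d (a ℚ.- b)) ⟩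
  ∣ a ∣ ℚ.* ∣ c ℚ.- d ∣ ℚ.+ ∣ d ∣ ℚ.* ∣ a ℚ.- b ∣
    ≤⟨ ℚ.+-mono-≤ (*-mono-≤ (ℚ.0≤∣p∣ a) (0≤δ) a≤K (ℚ.<⇒≤ q)) (*-mono-≤ (ℚ.0≤∣p∣ d) 0≤δ d≤M (ℚ.<⇒≤ p)) ⟩
  K ℚ.* δ ℚ.+ M ℚ.* δ
    ≡⟨ ℚ.*-distribʳ-+ δ K M ⟨
  (K ℚ.+ M) ℚ.* δ
    <⟨ small ⟩
  ε ∎
  where
  0≤δ : 0ℚ ℚ.≤ δ
  0≤δ = ℚ.≤-trans (ℚ.0≤∣p∣ (a ℚ.- b)) (ℚ.<⇒≤ p)

bounded : ∀ x → ∃ λ K → 0ℚ ℚ.≤ K × ∃ λ N → ∀ {n} → N ℕ.≤ n → ∣ seq x n ∣ ℚ.≤ K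
bounded x with cauchy x (ℚ.positive⁻¹ 1ℚ)
... | N , close = ∣ seq x N ∣ ℚ.+ 1ℚ , ℚ.+-mono-≤ (ℚ.0≤∣p∣ (seq x N)) 0≤1 , N , λ {n} N≤n → begin
  ∣ seq x n ∣                                      ≡⟨ cong ∣_∣ (solve 2 (λ a b → a := b :+ (a :- b)) refl (seq x n) (seq x N)) ⟩
  ∣ seq x N ℚ.+ (seq x n ℚ.- seq x N) ∣            ≤⟨ ℚ.∣p+q∣≤∣p∣+∣q∣ (seq x N) (seq x n ℚ.- seq x N) ⟩
  ∣ seq x N ∣ ℚ.+ ∣ seq x n ℚ.- seq x N ∣          ≤⟨ ℚ.+-monoʳ-≤ ∣ seq x N ∣ (ℚ.<⇒≤ (close N≤n ℕ.≤-refl)) ⟩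
  ∣ seq x N ∣ ℚ.+ 1ℚ                               ∎

fromℚ : ℚ → ℝ
fromℚ p = record
  { seq    = λ _ → p
  ; cauchy = λ {ε} 0<ε → 0 , λ _ _ → subst (ℚ._< ε) (sym (cong ∣_∣ (ℚ.+-inverseʳ p))) 0<ε
  }

fromℕ : ℕ → ℝ
fromℕ n = fromℚ (ι n)

0ℝ 1ℝ : ℝ
0ℝ = fromℚ 0ℚ
1ℝ = fromℚ 1ℚ

infix  8 -_
infixl 7 _*_
infixl 6 _+_ _-_

_+_ : ℝ → ℝ → ℝ
x + y = record
  { seq    = λ n → seq x n ℚ.+ seq y n
  ; cauchy = λ 0<ε →
      let (N , p) = cauchy x (half-pos 0<ε) ; (M , q) = cauchy y (half-pos 0<ε) in
      N ℕ.⊔ M , λ {m} {n} ≤m ≤n → ∣+-+∣ (seq x m) (seq x n) (seq y m) (seq y n)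
        (p (⊔ˡ {N} ≤m) (⊔ˡ {N} ≤n)) (q (⊔ʳ {N} ≤m) (⊔ʳ {N} ≤n))
  }

-_ : ℝ → ℝ
- x = record
  { seq    = λ n → ℚ.- seq x n
  ; cauchy = λ {ε} 0<ε → let (N , p) = cauchy x 0<ε in
      N , λ {m} {n} ≤m ≤n → subst (ℚ._< ε) (sym (∣neg-neg∣ (seq x m) (seq x n))) (p ≤m ≤n)
  }

_-_ : ℝ → ℝ → ℝ
x - y = x + (- y)

_*_ : ℝ → ℝ → ℝ
x * y = record
  { seq    = λ n → seq x n ℚ.* seq y n
  ; cauchy = λ 0<ε →
      let (K , 0≤K , A , x≤K) = bounded x
          (M , 0≤M , B , y≤M) = bounded y
          (δ , 0<δ , small)   = scale (K ℚ.+ M) (ℚ.+-mono-≤ 0≤K 0≤M) 0<ε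
          (N , p)             = cauchy x 0<δ
          (O , q)             = cauchy y 0<δ
      in (A ℕ.⊔ B) ℕ.⊔ (N ℕ.⊔ O) , λ {m} {n} ≤m ≤n →
        ∣*-*∣ (seq x m) (seq x n) (seq y m) (seq y n)
          (x≤K (⊔ˡ {A} (⊔ˡ {A ℕ.⊔ B} ≤m))) (y≤M (⊔ʳ {A} (⊔ˡ {A ℕ.⊔ B} ≤n))) small
          (p (⊔ˡ {N} (⊔ʳ {A ℕ.⊔ B} ≤m)) (⊔ˡ {N} (⊔ʳ {A ℕ.⊔ B} ≤n)))
          (q (⊔ʳ {N} (⊔ʳ {A ℕ.⊔ B} ≤m)) (⊔ʳ {N} (⊔ʳ {A ℕ.⊔ B} ≤n)))
  }

≈-sym : ∀ {x y} → x ≈ y → y ≈ x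
≈-sym {x} {y} x≈y {ε} 0<ε = let (N , p) = x≈y 0<ε in
  N , λ {n} ≤n → subst (ℚ._< ε) (∣-∣-sym (seq x n) (seq y n)) (p ≤n)

≈-trans : ∀ {x y z} → x ≈ y → y ≈ z → x ≈ z
≈-trans {x} {y} {z} x≈y y≈z {ε} 0<ε =
  let (N , p) = x≈y (half-pos 0<ε) ; (M , q) = y≈z (half-pos 0<ε) in
  N ℕ.⊔ M , λ {n} ≤n → ℚ.≤-<-trans (∣-∣-triangle (seq x n) (seq y n) (seq z n))
    (subst (_ ℚ.<_) (half+half ε) (ℚ.+-mono-< (p (⊔ˡ {N} ≤n)) (q (⊔ʳ {N} ≤n))))

+-cong : ∀ {x y u v} → x ≈ y → u ≈ v → x + u ≈ y + v
+-cong {x} {y} {u} {v} x≈y u≈v 0<ε =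
  let (N , p) = x≈y (half-pos 0<ε) ; (M , q) = u≈v (half-pos 0<ε) in
  N ℕ.⊔ M , λ {n} ≤n → ∣+-+∣ (seq x n) (seq y n) (seq u n) (seq v n) (p (⊔ˡ {N} ≤n)) (q (⊔ʳ {N} ≤n))

neg-cong : ∀ {x y} → x ≈ y → - x ≈ - y
neg-cong {x} {y} x≈y {ε} 0<ε = let (N , p) = x≈y 0<ε in
  N , λ {n} ≤n → subst (ℚ._< ε) (sym (∣neg-neg∣ (seq x n) (seq y n))) (p ≤n)

*-cong : ∀ {x y u v} → x ≈ y → u ≈ v → x * u ≈ y * v
*-cong {x} {y} {u} {v} x≈y u≈v 0<ε =
  let (K , 0≤K , A , x≤K) = bounded x
      (M , 0≤M , B , v≤M) = bounded v
      (δ , 0<δ , small)   = scale (K ℚ.+ M) (ℚ.+-mono-≤ 0≤K 0≤M) 0<ε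
      (N , p)             = x≈y 0<δ
      (O , q)             = u≈v 0<δ
  in (A ℕ.⊔ B) ℕ.⊔ (N ℕ.⊔ O) , λ {n} ≤n →
    ∣*-*∣ (seq x n) (seq y n) (seq u n) (seq v n)
      (x≤K (⊔ˡ {A} (⊔ˡ {A ℕ.⊔ B} ≤n))) (v≤M (⊔ʳ {A} (⊔ˡ {A ℕ.⊔ B} ≤n))) small
      (p (⊔ˡ {N} (⊔ʳ {A ℕ.⊔ B} ≤n))) (q (⊔ʳ {N} (⊔ʳ {A ℕ.⊔ B} ≤n)))

ℝ-commutativeRing : CommutativeRing 0ℓ 0ℓ
ℝ-commutativeRing = record
  { Carrier = ℝ ; _≈_ = _≈_ ; _+_ = _+_ ; _*_ = _*_ ; -_ = -_ ; 0# = 0ℝ ; 1# = 1ℝ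
  ; isCommutativeRing = record
    { isRing = record
      { +-isAbelianGroup = record
        { isGroup = record
          { isMonoid = record
            { isSemigroup = record
              { isMagma = record
                { isEquivalence = record
                  { refl  = λ {x} → pointwise {x} {x} (λ _ → refl)
                  ; sym   = λ {x} {y} → ≈-sym {x} {y}
                  ; trans = λ {x} {y} {z} → ≈-trans {x} {y} {z}
                  }
                ; ∙-cong = λ {x} {y} {u} {v} → +-cong {x} {y} {u} {v}
                }
              ; assoc = λ x y z → pointwise {(x + y) + z} {x + (y + z)} (λ n → ℚ.+-assoc (seq x n) (seq y n) (seq z n))
              }
            ; identity = (λ x → pointwise {0ℝ + x} {x} (λ n → ℚ.+-identityˡ (seq x n)))
                       , (λ x → pointwise {x + 0ℝ} {x} (λ n → ℚ.+-identityʳ (seq x n)))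
            }
          ; inverse = (λ x → pointwise {(- x) + x} {0ℝ} (λ n → ℚ.+-inverseˡ (seq x n)))
                    , (λ x → pointwise {x + (- x)} {0ℝ} (λ n → ℚ.+-inverseʳ (seq x n)))
          ; ⁻¹-cong = λ {x} {y} → neg-cong {x} {y}
          }
        ; comm = λ x y → pointwise {x + y} {y + x} (λ n → ℚ.+-comm (seq x n) (seq y n))
        }
      ; *-cong = λ {x} {y} {u} {v} → *-cong {x} {y} {u} {v}
      ; *-assoc = λ x y z → pointwise {(x * y) * z} {x * (y * z)} (λ n → ℚ.*-assoc (seq x n) (seq y n) (seq z n))
      ; *-identity = (λ x → pointwise {1ℝ * x} {x} (λ n → ℚ.*-identityˡ (seq x n)))
                   , (λ x → pointwise {x * 1ℝ} {x} (λ n → ℚ.*-identityʳ (seq x n)))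
      ; distrib = (λ x y z → pointwise {x * (y + z)} {x * y + x * z} (λ n → ℚ.*-distribˡ-+ (seq x n) (seq y n) (seq z n)))
                , (λ x y z → pointwise {(y + z) * x} {y * x + z * x} (λ n → ℚ.*-distribʳ-+ (seq x n) (seq y n) (seq z n)))
      }
    ; *-comm = λ x y → pointwise {x * y} {y * x} (λ n → ℚ.*-comm (seq x n) (seq y n))
    }
  }

open Algebra.Definitions.RawSemiring (Semiring.rawSemiring (CommutativeRing.semiring ℝ-commutativeRing)) public using (_^_; sum)

recipℚ : ℚ → ℚ
recipℚ p with p ℚ.≟ 0ℚ
... | yes _  = 0ℚ
... | no p≢0 = (ℚ.1/ p) ⦃ ℚ.≢-nonZero p≢0 ⦄

recipℚ-inverse : ∀ {p} → 0ℚ ℚ.< p → recipℚ p ℚ.* p ≡ 1ℚ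
recipℚ-inverse {p} 0<p with p ℚ.≟ 0ℚ
... | yes refl = contradiction 0<p (ℚ.<-irrefl refl)
... | no p≢0   = ℚ.*-inverseˡ p ⦃ ℚ.≢-nonZero p≢0 ⦄

recipℚ-lipschitz : ∀ {δ e} → 0ℚ ℚ.< δ → 0ℚ ℚ.< e → e ℚ.* δ ≡ 1ℚ → ∀ {a b} → δ ℚ.≤ a → δ ℚ.≤ b →
                   ∣ recipℚ a ℚ.- recipℚ b ∣ ℚ.≤ e ℚ.* e ℚ.* ∣ a ℚ.- b ∣
recipℚ-lipschitz {δ} {e} 0<δ 0<e eδ≡1 {a} {b} δ≤a δ≤b = begin
  ∣ A ℚ.- B ∣
    ≡⟨ cong ∣_∣ (cong₂ ℚ._-_ (trans (sym (ℚ.*-identityʳ A)) (cong (A ℚ.*_) (sym Bb≡1)))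
                             (trans (sym (ℚ.*-identityʳ B)) (cong (B ℚ.*_) (sym Aa≡1)))) ⟩
  ∣ A ℚ.* (B ℚ.* b) ℚ.- B ℚ.* (A ℚ.* a) ∣
    ≡⟨ cong ∣_∣ (solve 4 (λ A B a b → A :* (B :* b) :- B :* (A :* a) := A :* B :* (b :- a)) refl A B a b) ⟩
  ∣ A ℚ.* B ℚ.* (b ℚ.- a) ∣
    ≡⟨ ℚ.∣p*q∣≡∣p∣*∣q∣ (A ℚ.* B) (b ℚ.- a) ⟩
  ∣ A ℚ.* B ∣ ℚ.* ∣ b ℚ.- a ∣
    ≡⟨ cong₂ ℚ._*_ (ℚ.0≤p⇒∣p∣≡p (*-nonneg 0≤A 0≤B)) (∣-∣-sym b a) ⟩
  A ℚ.* B ℚ.* ∣ a ℚ.- b ∣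
    ≤⟨ ℚ.*-monoʳ-≤-nonNeg ∣ a ℚ.- b ∣ ⦃ ℚ.∣-∣-nonNeg (a ℚ.- b) ⦄ (*-mono-≤ 0≤A (ℚ.<⇒≤ 0<e) (≤e Aa≡1 0≤A δ≤a) (≤e Bb≡1 0≤B δ≤b)) ⟩
  e ℚ.* e ℚ.* ∣ a ℚ.- b ∣ ∎
  where
  A B : ℚ
  A = recipℚ a
  B = recipℚ b
  Aa≡1 : A ℚ.* a ≡ 1ℚ
  Aa≡1 = recipℚ-inverse (ℚ.<-≤-trans 0<δ δ≤a)
  Bb≡1 : B ℚ.* b ≡ 1ℚ
  Bb≡1 = recipℚ-inverse (ℚ.<-≤-trans 0<δ δ≤b)
  nonneg : ∀ {p r} → r ℚ.* p ≡ 1ℚ → δ ℚ.≤ p → 0ℚ ℚ.≤ r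
  nonneg {p} {r} rp≡1 δ≤p = ℚ.<⇒≤ (ℚ.*-cancelʳ-<-nonNeg p ⦃ ℚ.nonNegative (ℚ.≤-trans (ℚ.<⇒≤ 0<δ) δ≤p) ⦄
    (begin-strict 0ℚ ℚ.* p ≡⟨ ℚ.*-zeroˡ p ⟩ 0ℚ <⟨ ℚ.positive⁻¹ 1ℚ ⟩ 1ℚ ≡⟨ rp≡1 ⟨ r ℚ.* p ∎))
  0≤A : 0ℚ ℚ.≤ A
  0≤A = nonneg Aa≡1 δ≤a
  0≤B : 0ℚ ℚ.≤ B
  0≤B = nonneg Bb≡1 δ≤b
  ≤e : ∀ {p r} → r ℚ.* p ≡ 1ℚ → 0ℚ ℚ.≤ r → δ ℚ.≤ p → r ℚ.≤ e
  ≤e {p} {r} rp≡1 0≤r δ≤p = begin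
    r                  ≡⟨ ℚ.*-identityʳ r ⟨
    r ℚ.* 1ℚ           ≡⟨ cong (r ℚ.*_) eδ≡1 ⟨
    r ℚ.* (e ℚ.* δ)    ≤⟨ ℚ.*-monoˡ-≤-nonNeg r ⦃ ℚ.nonNegative 0≤r ⦄ (ℚ.*-monoˡ-≤-nonNeg e ⦃ ℚ.nonNegative (ℚ.<⇒≤ 0<e) ⦄ δ≤p) ⟩
    r ℚ.* (e ℚ.* p)    ≡⟨ solve 3 (λ r e p → r :* (e :* p) := e :* (r :* p)) refl r e p ⟩
    e ℚ.* (r ℚ.* p)    ≡⟨ cong (e ℚ.*_) rp≡1 ⟩
    e ℚ.* 1ℚ           ≡⟨ ℚ.*-identityʳ e ⟩
    e                  ∎

0<⇒≥δ : ∀ {x δ n} → seq 0ℝ n ℚ.+ δ ℚ.≤ seq x n → δ ℚ.≤ seq x n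
0<⇒≥δ {δ = δ} = ℚ.≤-trans (ℚ.≤-reflexive (sym (ℚ.+-identityˡ δ)))

recip : (x : ℝ) → 0ℝ < x → ℝ
recip x (δ , 0<δ , N , above) = record
  { seq    = λ n → recipℚ (seq x n)
  ; cauchy = λ 0<ε →
      let (e , 0<e , eδ≡1)   = inverse δ 0<δ
          0≤ee               = *-nonneg (ℚ.<⇒≤ 0<e) (ℚ.<⇒≤ 0<e)
          (η , 0<η , small)  = scale (e ℚ.* e) 0≤ee 0<ε
          (M , close)        = cauchy x 0<η
      in N ℕ.⊔ M , λ {m} {n} ≤m ≤n → ℚ.≤-<-trans
        (ℚ.≤-trans
          (recipℚ-lipschitz 0<δ 0<e eδ≡1 (0<⇒≥δ {x} {n = m} (above (⊔ˡ {N} ≤m))) (0<⇒≥δ {x} {n = n} (above (⊔ˡ {N} ≤n))))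
          (ℚ.*-monoˡ-≤-nonNeg (e ℚ.* e) ⦃ ℚ.nonNegative 0≤ee ⦄ (ℚ.<⇒≤ (close (⊔ʳ {N} ≤m) (⊔ʳ {N} ≤n)))))
        small
  }

recip-inverseˡ : ∀ x (0<x : 0ℝ < x) → recip x 0<x * x ≈ 1ℝ
recip-inverseˡ x (δ , 0<δ , N , above) {ε} 0<ε = N , λ {n} N≤n →
  subst (ℚ._< ε) (sym (cong (λ z → ∣ z ℚ.- 1ℚ ∣)
    (recipℚ-inverse (ℚ.<-≤-trans 0<δ (0<⇒≥δ {x} {n = n} (above N≤n)))))) 0<ε

-- The sum of ∑ⱼ aⱼ yʲ, approximated by its n-th partial sum at the n-th
-- approximation of y.  The bound gives convergence on ∣ y ∣ ≤ r, uniformly.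
powerSeries : ∀ (a : ℕ → ℚ) {r} → GeometricBound a r →
              (y : ℝ) → (∃ λ N → ∀ {n} → N ℕ.≤ n → ∣ seq y n ∣ ℚ.≤ r) → ℝ
powerSeries a {r} b y (N , y≤r) = record
  { seq    = λ n → eval a n (seq y n)
  ; cauchy = λ {ε} 0<ε →
      let (A , small)         = decay (C ℚ.* g) 0≤Cg (half-pos 0<ε)
          (δ , 0<δ , small′)  = scale L 0≤L (half-pos 0<ε)
          (M , close)         = cauchy y 0<δ
          main : ∀ {m n} → (N ℕ.⊔ (A ℕ.⊔ M)) ℕ.≤ m → (N ℕ.⊔ (A ℕ.⊔ M)) ℕ.≤ n → n ℕ.≤ m →
                 ∣ eval a m (seq y m) ℚ.- eval a n (seq y n) ∣ ℚ.< ε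
          main {m} {n} ≤m ≤n n≤m = begin-strict
            ∣ eval a m (seq y m) ℚ.- eval a n (seq y n) ∣
              ≤⟨ ∣-∣-triangle (eval a m (seq y m)) (eval a n (seq y m)) (eval a n (seq y n)) ⟩
            ∣ eval a m (seq y m) ℚ.- eval a n (seq y m) ∣ ℚ.+ ∣ eval a n (seq y m) ℚ.- eval a n (seq y n) ∣
              ≤⟨ ℚ.+-mono-≤ (eval-tail {seq y m} (y≤r (⊔ˡ {N} ≤m)) n≤m)
                            (eval-lipschitz {seq y m} {seq y n} (y≤r (⊔ˡ {N} ≤m)) (y≤r (⊔ˡ {N} ≤n)) n) ⟩
            C ℚ.* g ℚ.* RationalLemmas._^_ ρ n ℚ.+ L ℚ.* ∣ seq y m ℚ.- seq y n ∣
              <⟨ ℚ.+-mono-<-≤ (small n (⊔ˡ {A} (⊔ʳ {N} ≤n)))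
                   (ℚ.*-monoˡ-≤-nonNeg L ⦃ ℚ.nonNegative 0≤L ⦄
                     (ℚ.<⇒≤ (close (⊔ʳ {A} (⊔ʳ {N} ≤m)) (⊔ʳ {A} (⊔ʳ {N} ≤n))))) ⟩
            ½ ℚ.* ε ℚ.+ L ℚ.* δ
              <⟨ ℚ.+-monoʳ-< (½ ℚ.* ε) small′ ⟩
            ½ ℚ.* ε ℚ.+ ½ ℚ.* ε
              ≡⟨ half+half ε ⟩
            ε ∎
      in N ℕ.⊔ (A ℕ.⊔ M) , λ {m} {n} ≤m ≤n → case-≤ {ε} {m} {n} (main ≤m ≤n) (main ≤n ≤m)
  }
  where
  open GeometricBound b
  open Geometric 0≤ρ ρ<1
  case-≤ : ∀ {ε m n} →
           (n ℕ.≤ m → ∣ eval a m (seq y m) ℚ.- eval a n (seq y n) ∣ ℚ.< ε) →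
           (m ℕ.≤ n → ∣ eval a n (seq y n) ℚ.- eval a m (seq y m) ∣ ℚ.< ε) →
           ∣ eval a m (seq y m) ℚ.- eval a n (seq y n) ∣ ℚ.< ε
  case-≤ {ε} {m} {n} f h with ℕ.≤-total n m
  ... | inj₁ n≤m = f n≤m
  ... | inj₂ m≤n = subst (ℚ._< ε) (∣-∣-sym (eval a n (seq y n)) (eval a m (seq y m))) (h m≤n)

-- exp y = ∑ yʲ / j!
exp : ℝ → ℝ
exp y = let (r , 0≤r , y≤r) = bounded y in powerSeries 1/!_ (expBound r 0≤r) y y≤r

-- For 0 < q < 1, Mercator's series log q = - ∑_{j ≥ 1} (1 - q)ʲ / j.
log : (q : ℝ) → 0ℝ < q → q < 1ℝ → ℝ
log q (δ , 0<δ , N , above) (δ′ , 0<δ′ , M , below) =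
  - powerSeries mercator (mercatorBound r 0≤r r<1) (1ℝ - q) (N ℕ.⊔ M , λ {n} ≤n → u≤r {n} ≤n)
  where
  u : ℕ → ℚ
  u = seq (1ℝ - q)
  r : ℚ
  r = 1ℚ ℚ.- δ
  ≤u : ∀ {n} → N ℕ.⊔ M ℕ.≤ n → 0ℚ ℚ.≤ u n
  ≤u {n} ≤n = ≤⇒0≤- (ℚ.≤-trans (ℚ.≤-trans (ℚ.≤-reflexive (sym (ℚ.+-identityʳ (seq q n))))
                (ℚ.+-monoʳ-≤ (seq q n) (ℚ.<⇒≤ 0<δ′))) (below (⊔ʳ {N} ≤n)))
  u≤ : ∀ {n} → N ℕ.⊔ M ℕ.≤ n → u n ℚ.≤ r
  u≤ {n} ≤n = ℚ.+-monoʳ-≤ 1ℚ (ℚ.neg-antimono-≤ (0<⇒≥δ {q} {δ} {n} (above (⊔ˡ {N} ≤n))))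
  u≤r : ∀ {n} → N ℕ.⊔ M ℕ.≤ n → ∣ u n ∣ ℚ.≤ r
  u≤r {n} ≤n = ℚ.≤-trans (ℚ.≤-reflexive (ℚ.0≤p⇒∣p∣≡p (≤u {n} ≤n))) (u≤ {n} ≤n)
  0≤r : 0ℚ ℚ.≤ r
  0≤r = ℚ.≤-trans (≤u {N ℕ.⊔ M} ℕ.≤-refl) (u≤ {N ℕ.⊔ M} ℕ.≤-refl)
  r<1 : r ℚ.< 1ℚ
  r<1 = ℚ.+-monoʳ-< 1ℚ (ℚ.neg-antimono-< 0<δ)

∑[_⋯_] : ℕ → ℕ → (ℕ → ℝ) → ℝ
∑[ k ⋯ n ] f = sum {suc n ∸ k} (λ j → f (k ℕ.+ toℕ j))

FormalPowerSeries : Set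
FormalPowerSeries = ℕ → ℝ

infixl 7 _⊛_ _•_

_⊛_ : FormalPowerSeries → FormalPowerSeries → FormalPowerSeries
(f ⊛ h) n = ∑[ 0 ⋯ n ] λ i → f i * h (n ∸ i)

_•_ : ℝ → FormalPowerSeries → FormalPowerSeries
(c • f) n = c * f n

t^_ : ℕ → FormalPowerSeries
(t^ k) n = if n ℕ.≡ᵇ k then 1ℝ else 0ℝ

-- e^{a t}
exp[_t] : ℝ → FormalPowerSeries
exp[ a t] n = a ^ n * fromℚ (1/! n)

module qCalculus (q : ℝ) (0<q : 0ℝ < q) (q<1 : q < 1ℝ) where

  infix 8 q^_
  q^_ : ℝ → ℝ
  q^ y = exp (y * log q 0<q q<1)

  0<1-q : 0ℝ < 1ℝ - q
  0<1-q = let (δ , 0<δ , N , below) = q<1 in δ , 0<δ , N , λ {n} N≤n →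
    subst (ℚ._≤ 1ℚ ℚ.- seq q n) (solve 2 (λ a d → a :+ d :- a := con 0ℚ :+ d) refl (seq q n) δ)
      (ℚ.+-monoˡ-≤ (ℚ.- seq q n) (below N≤n))

  [_]q : ℝ → ℝ
  [ x ]q = (1ℝ - q^ x) * recip (1ℝ - q) 0<1-q

  generatingFunction : ℕ → ℝ → FormalPowerSeries
  generatingFunction k x = ([ x ]q ^ k * fromℚ (1/! k)) • (t^ k ⊛ exp[ [ 1ℝ - x ]q t])

  -- n! times the coefficient of tⁿ, that is, the sequence whose exponential
  -- generating function is generatingFunction k x.
  B : ℕ → ℕ → ℝ → ℝ
  B k n x = fromℕ (n !) * generatingFunction k x n

  B-generatingFunction : ∀ k x n → generatingFunction k x n ≈ B k n x * fromℚ (1/! n)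
  B-generatingFunction k x n = pointwise {generatingFunction k x n} {B k n x * fromℚ (1/! n)} λ m →
    let c = seq (generatingFunction k x n) m in
    sym (trans (solve 3 (λ i c f → i :* c :* f := f :* i :* c) refl (ι (n !)) c (1/! n))
        (trans (cong (ℚ._* c) (1/!-*-! n)) (ℚ.*-identityˡ c)))

{-# OPTIONS --safe #-}
module Submission where

-- The generating function gives B_{k,n}(x,q) = C(n,k) [x]^k [1-x]^{n-k}.  Since q^{1-x} q^x = q, one has
-- [1-x] = 1 - q^{1-x} [x]; expand its (n-k)-th power and use C(n,k) C(n-k,i-k) = C(i,k) C(n,i).
--
-- The analytic input is exp (x + y) = exp x exp y and exp (log q) = q.  For the former, the product of two
-- partial sums lies between partial sums of the Cauchy product once absolute values are taken.  For the
-- latter, the coefficients s_k(j) of (- log (1 - u))^k / k! are nonnegative, with ∑_k s_k(j) = 1 and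
-- ∑_k (-1)^k s_k(j) = 1, -1, 0, 0, … for j = 0, 1, 2, 3, …; so the n-th partial sum of exp at the n-th
-- partial sum of log (1 - u) differs from 1 - u by at most the tail ∑_{j ≥ n} u^j.

open import Algebra.Bundles using (CommutativeRing)
open import Data.Bool using (if_then_else_)
open import Data.Fin using (Fin; toℕ)
import Data.Fin as Fin
import Data.Fin.Properties as Fin
open import Data.Nat as ℕ using (ℕ; zero; suc; _∸_; _!)
open import Data.Nat.Combinatorics using (_C_; nCk≡n!/k![n-k]!; k![n∸k]!∣n!)
import Data.Nat.DivMod as ℕ
import Data.Nat.Properties as ℕ
open import Data.Product using (∃; _,_)
open import Data.Sum using (inj₁; inj₂)
open import Defs using (module RationalLemmas)
open import Function using (_∘_)
open import Relation.Binary.PropositionalEquality using (_≡_; refl; sym; trans; cong; cong₂; subst; module ≡-Reasoning)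

module RationalSeries where
  open RationalLemmas
  import Data.Integer as ℤ
  open import Data.Rational
  open import Data.Rational.Properties
  open import Data.Rational.Solver using (module +-*-Solver)
  open +-*-Solver

  -- Finite sums of rationals.

  NonNeg : (ℕ → ℚ) → Set
  NonNeg f = ∀ j → 0ℚ ≤ f j

  *-monoˡ : ∀ {p q r} → 0ℚ ≤ r → p ≤ q → r * p ≤ r * q
  *-monoˡ {r = r} 0≤r = *-monoˡ-≤-nonNeg r ⦃ nonNegative 0≤r ⦄

  *-monoʳ : ∀ {p q r} → 0ℚ ≤ r → p ≤ q → p * r ≤ q * r
  *-monoʳ {r = r} 0≤r = *-monoʳ-≤-nonNeg r ⦃ nonNegative 0≤r ⦄

  p≤∣p∣ : ∀ p → p ≤ ∣ p ∣
  p≤∣p∣ p with ≤-total 0ℚ p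
  ... | inj₁ 0≤p = ≤-reflexive (sym (0≤p⇒∣p∣≡p 0≤p))
  ... | inj₂ p≤0 = ≤-trans p≤0 (0≤∣p∣ p)

  partialSum-cong-< : ∀ {f g} n → (∀ j → j ℕ.< n → f j ≡ g j) → partialSum f n ≡ partialSum g n
  partialSum-cong-< zero    eq = refl
  partialSum-cong-< (suc n) eq = cong₂ _+_
    (partialSum-cong-< n (λ j j<n → eq j (ℕ.m<n⇒m<1+n j<n))) (eq n ℕ.≤-refl)

  partialSum-cong : ∀ {f g} → (∀ j → f j ≡ g j) → ∀ n → partialSum f n ≡ partialSum g n
  partialSum-cong eq n = partialSum-cong-< n (λ j _ → eq j)

  partialSum-0 : ∀ n → partialSum (λ _ → 0ℚ) n ≡ 0ℚ
  partialSum-0 zero    = refl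
  partialSum-0 (suc n) = trans (+-identityʳ _) (partialSum-0 n)

  partialSum-+ : ∀ f g n → partialSum (λ j → f j + g j) n ≡ partialSum f n + partialSum g n
  partialSum-+ f g zero    = refl
  partialSum-+ f g (suc n) = trans (cong (_+ (f n + g n)) (partialSum-+ f g n))
    (solve 4 (λ F G a b → (F :+ G) :+ (a :+ b) := (F :+ a) :+ (G :+ b)) refl
      (partialSum f n) (partialSum g n) (f n) (g n))

  partialSum-* : ∀ c f n → partialSum (λ j → c * f j) n ≡ c * partialSum f n
  partialSum-* c f zero    = sym (*-zeroʳ c)
  partialSum-* c f (suc n) = trans (cong (_+ c * f n) (partialSum-* c f n))
    (sym (*-distribˡ-+ c (partialSum f n) (f n)))

  partialSum-- : ∀ f g n → partialSum (λ j → f j - g j) n ≡ partialSum f n - partialSum g n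
  partialSum-- f g zero    = refl
  partialSum-- f g (suc n) = trans (cong (_+ (f n - g n)) (partialSum-- f g n))
    (solve 4 (λ F G a b → (F :- G) :+ (a :- b) := (F :+ a) :- (G :+ b)) refl
      (partialSum f n) (partialSum g n) (f n) (g n))

  partialSum-mono : ∀ {f g} n → (∀ j → j ℕ.< n → f j ≤ g j) → partialSum f n ≤ partialSum g n
  partialSum-mono zero    f≤g = ≤-refl
  partialSum-mono (suc n) f≤g = +-mono-≤
    (partialSum-mono n (λ j j<n → f≤g j (ℕ.m<n⇒m<1+n j<n))) (f≤g n ℕ.≤-refl)

  partialSum-nonneg : ∀ {f} → NonNeg f → ∀ n → 0ℚ ≤ partialSum f n
  partialSum-nonneg 0≤f zero    = ≤-refl
  partialSum-nonneg 0≤f (suc n) = +-mono-≤ (partialSum-nonneg 0≤f n) (0≤f n)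

  partialSum-monoʳ : ∀ {f} → NonNeg f → ∀ d n → partialSum f n ≤ partialSum f (d ℕ.+ n)
  partialSum-monoʳ 0≤f zero    n = ≤-refl
  partialSum-monoʳ 0≤f (suc d) n =
    ≤-trans (≤-reflexive (sym (+-identityʳ _))) (+-mono-≤ (partialSum-monoʳ 0≤f d n) (0≤f (d ℕ.+ n)))

  partialSum-mono-≤ : ∀ {f} → NonNeg f → ∀ {m n} → m ℕ.≤ n → partialSum f m ≤ partialSum f n
  partialSum-mono-≤ {f} 0≤f {m} {n} m≤n = subst (λ l → partialSum f m ≤ partialSum f l)
    (ℕ.m∸n+n≡m m≤n) (partialSum-monoʳ 0≤f (n ℕ.∸ m) m)

  partialSum-∣∣ : ∀ f n → ∣ partialSum f n ∣ ≤ partialSum (λ j → ∣ f j ∣) n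
  partialSum-∣∣ f zero    = ≤-refl
  partialSum-∣∣ f (suc n) = ≤-trans (∣p+q∣≤∣p∣+∣q∣ (partialSum f n) (f n))
    (+-monoˡ-≤ ∣ f n ∣ (partialSum-∣∣ f n))

  partialSum-head : ∀ f n → partialSum f (suc n) ≡ f 0 + partialSum (f ∘ suc) n
  partialSum-head f zero    = +-comm 0ℚ (f 0)
  partialSum-head f (suc n) = trans (cong (_+ f (suc n)) (partialSum-head f n))
    (+-assoc (f 0) (partialSum (f ∘ suc) n) (f (suc n)))

  partialSum-swap : ∀ (f : ℕ → ℕ → ℚ) m n →
    partialSum (λ i → partialSum (f i) n) m ≡ partialSum (λ j → partialSum (λ i → f i j) m) n
  partialSum-swap f m zero    = partialSum-0 m
  partialSum-swap f m (suc n) = trans (partialSum-+ (λ i → partialSum (f i) n) (λ i → f i n) m)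
    (cong (_+ partialSum (λ i → f i n) m) (partialSum-swap f m n))

  partialSum-1 : ∀ n → partialSum (λ _ → 1ℚ) n ≡ ι n
  partialSum-1 zero    = refl
  partialSum-1 (suc n) = trans (cong (_+ 1ℚ) (partialSum-1 n)) (sym (ι-suc n))

  -- Cauchy products

  infixl 7 _⋆_

  -- The recursion peels off `f 0` and shifts `f`, so facts about `_⋆_` follow by induction on the
  -- index with `f` varying.
  _⋆_ : (ℕ → ℚ) → (ℕ → ℚ) → ℕ → ℚ
  (f ⋆ g) zero    = f 0 * g 0
  (f ⋆ g) (suc n) = f 0 * g (suc n) + ((f ∘ suc) ⋆ g) n

  ⋆-cong : ∀ {f f′ g g′} → (∀ j → f j ≡ f′ j) → (∀ j → g j ≡ g′ j) → ∀ n → (f ⋆ g) n ≡ (f′ ⋆ g′) n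
  ⋆-cong p q zero    = cong₂ _*_ (p 0) (q 0)
  ⋆-cong p q (suc n) = cong₂ _+_ (cong₂ _*_ (p 0) (q (suc n))) (⋆-cong (p ∘ suc) q n)

  ⋆-+ˡ : ∀ f g h n → ((λ j → f j + g j) ⋆ h) n ≡ (f ⋆ h) n + (g ⋆ h) n
  ⋆-+ˡ f g h zero    = *-distribʳ-+ (h 0) (f 0) (g 0)
  ⋆-+ˡ f g h (suc n) = trans (cong (((f 0 + g 0) * h (suc n)) +_) (⋆-+ˡ (f ∘ suc) (g ∘ suc) h n))
    (solve 5 (λ a b c F G → (a :+ b) :* c :+ (F :+ G) := (a :* c :+ F) :+ (b :* c :+ G)) refl
      (f 0) (g 0) (h (suc n)) (((f ∘ suc) ⋆ h) n) (((g ∘ suc) ⋆ h) n))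

  ⋆-*ˡ : ∀ c f g n → ((λ j → c * f j) ⋆ g) n ≡ c * (f ⋆ g) n
  ⋆-*ˡ c f g zero    = *-assoc c (f 0) (g 0)
  ⋆-*ˡ c f g (suc n) = trans (cong ((c * f 0 * g (suc n)) +_) (⋆-*ˡ c (f ∘ suc) g n))
    (solve 4 (λ c a b F → c :* a :* b :+ c :* F := c :* (a :* b :+ F)) refl
      c (f 0) (g (suc n)) (((f ∘ suc) ⋆ g) n))

  ⋆-*ʳ : ∀ c f g n → (f ⋆ (λ j → c * g j)) n ≡ c * (f ⋆ g) n
  ⋆-*ʳ c f g zero    = solve 3 (λ c a b → a :* (c :* b) := c :* (a :* b)) refl c (f 0) (g 0)
  ⋆-*ʳ c f g (suc n) = trans (cong ((f 0 * (c * g (suc n))) +_) (⋆-*ʳ c (f ∘ suc) g n))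
    (solve 4 (λ c a b F → a :* (c :* b) :+ c :* F := c :* (a :* b :+ F)) refl
      c (f 0) (g (suc n)) (((f ∘ suc) ⋆ g) n))

  ⋆-zeroʳ : ∀ f n → (f ⋆ (λ _ → 0ℚ)) n ≡ 0ℚ
  ⋆-zeroʳ f zero    = *-zeroʳ (f 0)
  ⋆-zeroʳ f (suc n) = cong₂ _+_ (*-zeroʳ (f 0)) (⋆-zeroʳ (f ∘ suc) n)

  ⋆-nonneg : ∀ {f g} → NonNeg f → NonNeg g → NonNeg (f ⋆ g)
  ⋆-nonneg 0≤f 0≤g zero    = *-nonneg (0≤f 0) (0≤g 0)
  ⋆-nonneg 0≤f 0≤g (suc n) = +-mono-≤ (*-nonneg (0≤f 0) (0≤g (suc n))) (⋆-nonneg (0≤f ∘ suc) 0≤g n)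

  -- Every product contributing to degree n carries y^i and y^(n-i). This passes from coefficients
  -- to evaluated terms.
  ⋆-scale : ∀ f g y n → ((λ j → f j * y ^ j) ⋆ (λ j → g j * y ^ j)) n ≡ (f ⋆ g) n * y ^ n
  ⋆-scale f g y zero    = solve 2 (λ a b → a :* con 1ℚ :* (b :* con 1ℚ) := a :* b :* con 1ℚ) refl (f 0) (g 0)
  ⋆-scale f g y (suc n) = begin
    f 0 * 1ℚ * (g (suc n) * (y * y ^ n)) + ((λ j → f (suc j) * (y * y ^ j)) ⋆ G) n
      ≡⟨ cong ((f 0 * 1ℚ * (g (suc n) * (y * y ^ n))) +_) (trans
           (⋆-cong {g = G} (λ j → solve 3 (λ a y p → a :* (y :* p) := y :* (a :* p)) refl (f (suc j)) y (y ^ j)) (λ _ → refl) n)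
           (trans (⋆-*ˡ y (λ j → f (suc j) * y ^ j) G n) (cong (y *_) (⋆-scale (f ∘ suc) g y n)))) ⟩
    f 0 * 1ℚ * (g (suc n) * (y * y ^ n)) + y * (((f ∘ suc) ⋆ g) n * y ^ n)
      ≡⟨ solve 5 (λ a b y p F → a :* con 1ℚ :* (b :* (y :* p)) :+ y :* (F :* p) := (a :* b :+ F) :* (y :* p)) refl
           (f 0) (g (suc n)) y (y ^ n) (((f ∘ suc) ⋆ g) n) ⟩
    (f 0 * g (suc n) + ((f ∘ suc) ⋆ g) n) * (y * y ^ n) ∎
    where
    open ≡-Reasoning
    G : ℕ → ℚ
    G j = g j * y ^ j

  -- The constant sequence 1 is the series of 1/(1 - u); multiplying by it accumulates coefficients.
  ⋆-1ˡ : ∀ g n → ((λ _ → 1ℚ) ⋆ g) n ≡ partialSum g (suc n)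
  ⋆-1ˡ g zero    = trans (*-identityˡ (g 0)) (sym (+-identityˡ (g 0)))
  ⋆-1ˡ g (suc n) = trans (cong₂ _+_ (*-identityˡ (g (suc n))) (⋆-1ˡ g n))
    (+-comm (g (suc n)) (partialSum g (suc n)))

  -- The left side sums `f i * g j` over the triangle i + j <= n. The row i = 0 is split off; the
  -- other rows form the next smaller triangle for the shifted `f`.
  partialSum-⋆ : ∀ f g n → partialSum (f ⋆ g) (suc n) ≡ f 0 * partialSum g (suc n) + partialSum ((f ∘ suc) ⋆ g) n
  partialSum-⋆ f g zero    = solve 2 (λ a b → con 0ℚ :+ a :* b := a :* (con 0ℚ :+ b) :+ con 0ℚ) refl (f 0) (g 0)
  partialSum-⋆ f g (suc n) = trans (cong (_+ (f ⋆ g) (suc n)) (partialSum-⋆ f g n))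
    (solve 5 (λ a G b F c → (a :* G :+ F) :+ (a :* b :+ c) := a :* (G :+ b) :+ (F :+ c)) refl
      (f 0) (partialSum g (suc n)) (g (suc n)) (partialSum ((f ∘ suc) ⋆ g) n) (((f ∘ suc) ⋆ g) n))

  -- Associativity with the factor 1/(1 - u): both sides are coefficients of f g / (1 - u).
  ⋆-partialSum : ∀ f g n → (f ⋆ (λ j → partialSum g (suc j))) n ≡ partialSum (f ⋆ g) (suc n)
  ⋆-partialSum f g zero    = solve 2 (λ a b → a :* (con 0ℚ :+ b) := con 0ℚ :+ a :* b) refl (f 0) (g 0)
  ⋆-partialSum f g (suc n) = trans (cong ((f 0 * partialSum g (suc (suc n))) +_) (⋆-partialSum (f ∘ suc) g n))
    (sym (partialSum-⋆ f g (suc n)))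

  -- The triangle i + j < n lies in the square i, j < n.
  partialSum-⋆-≤ : ∀ {f g} → NonNeg f → NonNeg g → ∀ n → partialSum (f ⋆ g) n ≤ partialSum f n * partialSum g n
  partialSum-⋆-≤ 0≤f 0≤g zero    = ≤-refl
  partialSum-⋆-≤ {f} {g} 0≤f 0≤g (suc n) = begin
    partialSum (f ⋆ g) (suc n)
      ≡⟨ partialSum-⋆ f g n ⟩
    f 0 * G + partialSum ((f ∘ suc) ⋆ g) n
      ≤⟨ +-monoʳ-≤ (f 0 * G) (≤-trans (partialSum-⋆-≤ (0≤f ∘ suc) 0≤g n)
           (*-monoˡ (partialSum-nonneg (0≤f ∘ suc) n) (partialSum-monoʳ 0≤g 1 n))) ⟩
    f 0 * G + partialSum (f ∘ suc) n * G
      ≡⟨ *-distribʳ-+ G (f 0) (partialSum (f ∘ suc) n) ⟨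
    (f 0 + partialSum (f ∘ suc) n) * G
      ≡⟨ cong (_* G) (partialSum-head f n) ⟨
    partialSum f (suc n) * G ∎
    where
    open ≤-Reasoning
    G : ℚ
    G = partialSum g (suc n)

  -- The rectangle i < m, j < n lies in the triangle i + j < m + n.
  partialSum-*-≤ : ∀ {f g} → NonNeg f → NonNeg g → ∀ m n →
    partialSum f m * partialSum g n ≤ partialSum (f ⋆ g) (m ℕ.+ n)
  partialSum-*-≤ {f} {g} 0≤f 0≤g zero    n =
    ≤-trans (≤-reflexive (*-zeroˡ (partialSum g n))) (partialSum-nonneg (⋆-nonneg 0≤f 0≤g) n)
  partialSum-*-≤ {f} {g} 0≤f 0≤g (suc m) n = begin
    partialSum f (suc m) * G
      ≡⟨ cong (_* G) (partialSum-head f m) ⟩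
    (f 0 + partialSum (f ∘ suc) m) * G
      ≡⟨ *-distribʳ-+ G (f 0) (partialSum (f ∘ suc) m) ⟩
    f 0 * G + partialSum (f ∘ suc) m * G
      ≤⟨ +-mono-≤ (*-monoˡ (0≤f 0) (partialSum-monoʳ 0≤g (suc m) n)) (partialSum-*-≤ (0≤f ∘ suc) 0≤g m n) ⟩
    f 0 * partialSum g (suc (m ℕ.+ n)) + partialSum ((f ∘ suc) ⋆ g) (m ℕ.+ n)
      ≡⟨ partialSum-⋆ f g (m ℕ.+ n) ⟨
    partialSum (f ⋆ g) (suc (m ℕ.+ n)) ∎
    where
    open ≤-Reasoning
    G : ℚ
    G = partialSum g n

  -- Square minus triangle: the sum of `f i * g j` over i, j < n with i + j >= n.
  defect : (ℕ → ℚ) → (ℕ → ℚ) → ℕ → ℚ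
  defect f g n = partialSum f n * partialSum g n - partialSum (f ⋆ g) n

  -- The row i = 0 drops out. After the shift of `f`, the column j = n is complete and the rest is
  -- the defect of size `n`.
  defect-suc : ∀ f g n → defect f g (suc n) ≡ defect (f ∘ suc) g n + partialSum (f ∘ suc) n * g n
  defect-suc f g n = trans
    (cong₂ (λ s t → s * partialSum g (suc n) - t) (partialSum-head f n) (partialSum-⋆ f g n))
    (solve 5 (λ a F G b H → (a :+ F) :* (G :+ b) :- (a :* (G :+ b) :+ H) := (F :* G :- H) :+ F :* b) refl
      (f 0) (partialSum (f ∘ suc) n) (partialSum g n) (g n) (partialSum ((f ∘ suc) ⋆ g) n))

  -- `defect-suc` builds the defect from products without subtraction, so the triangle inequality
  -- applies term by term.
  ∣defect∣≤ : ∀ f g n → ∣ defect f g n ∣ ≤ defect (∣_∣ ∘ f) (∣_∣ ∘ g) n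
  ∣defect∣≤ f g zero    = ≤-refl
  ∣defect∣≤ f g (suc n) = begin
    ∣ defect f g (suc n) ∣
      ≡⟨ cong ∣_∣ (defect-suc f g n) ⟩
    ∣ defect (f ∘ suc) g n + F * g n ∣
      ≤⟨ ∣p+q∣≤∣p∣+∣q∣ (defect (f ∘ suc) g n) (F * g n) ⟩
    ∣ defect (f ∘ suc) g n ∣ + ∣ F * g n ∣
      ≤⟨ +-mono-≤ (∣defect∣≤ (f ∘ suc) g n)
           (≤-trans (≤-reflexive (∣p*q∣≡∣p∣*∣q∣ F (g n))) (*-monoʳ (0≤∣p∣ (g n)) (partialSum-∣∣ (f ∘ suc) n))) ⟩
    defect (∣_∣ ∘ f ∘ suc) (∣_∣ ∘ g) n + partialSum (∣_∣ ∘ f ∘ suc) n * ∣ g n ∣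
      ≡⟨ defect-suc (∣_∣ ∘ f) (∣_∣ ∘ g) n ⟨
    defect (∣_∣ ∘ f) (∣_∣ ∘ g) (suc n) ∎
    where
    open ≤-Reasoning
    F : ℚ
    F = partialSum (f ∘ suc) n

  -- Formal derivatives and comparison of coefficients.

  ∂ : (ℕ → ℚ) → ℕ → ℚ
  ∂ f j = ι (suc j) * f (suc j)

  -- The Leibniz rule. Since f = f 0 + u f′, the derivative of f is f′ + u ∂ f′, which is `∂-shift`;
  -- the splitting n + 2 = (n + 1) + 1 separates the two contributions.
  ∂-⋆ : ∀ f g n → ∂ (f ⋆ g) n ≡ (∂ f ⋆ g) n + (f ⋆ ∂ g) n
  ∂-⋆ f g zero    = solve 4 (λ a b c d → con 1ℚ :* (a :* d :+ c :* b) := con 1ℚ :* c :* b :+ a :* (con 1ℚ :* d)) refl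
                      (f 0) (g 0) (f 1) (g 1)
  ∂-⋆ f g (suc n) = begin
    i₂ * (f 0 * g₂ + (f′ ⋆ g) (suc n))
      ≡⟨ trans (cong (_* (f 0 * g₂ + (f′ ⋆ g) (suc n))) (ι-suc (suc n)))
           (trans (solve 4 (λ i a b F → (i :+ con 1ℚ) :* (a :* b :+ F) := i :* F :+ F :+ a :* ((i :+ con 1ℚ) :* b)) refl
                    i₁ (f 0) g₂ ((f′ ⋆ g) (suc n)))
             (cong (λ i → i₁ * (f′ ⋆ g) (suc n) + (f′ ⋆ g) (suc n) + f 0 * (i * g₂)) (sym (ι-suc (suc n))))) ⟩
    i₁ * (f′ ⋆ g) (suc n) + (f′ ⋆ g) (suc n) + f 0 * (i₂ * g₂)
      ≡⟨ cong (λ s → s + (f′ ⋆ g) (suc n) + f 0 * (i₂ * g₂)) (∂-⋆ f′ g n) ⟩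
    ((∂ f′ ⋆ g) n + (f′ ⋆ ∂ g) n) + (f 1 * g (suc n) + ((f′ ∘ suc) ⋆ g) n) + f 0 * (i₂ * g₂)
      ≡⟨ solve 6 (λ P Q a b R c → (P :+ Q) :+ (a :* b :+ R) :+ c := (con 1ℚ :* a :* b :+ (P :+ R)) :+ (c :+ Q)) refl
           ((∂ f′ ⋆ g) n) ((f′ ⋆ ∂ g) n) (f 1) (g (suc n)) (((f′ ∘ suc) ⋆ g) n) (f 0 * (i₂ * g₂)) ⟩
    (1ℚ * f 1 * g (suc n) + ((∂ f′ ⋆ g) n + ((f′ ∘ suc) ⋆ g) n)) + (f 0 * (i₂ * g₂) + (f′ ⋆ ∂ g) n)
      ≡⟨ cong (λ s → (1ℚ * f 1 * g (suc n) + s) + (f 0 * (i₂ * g₂) + (f′ ⋆ ∂ g) n))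
           (trans (sym (⋆-+ˡ (∂ f′) (f′ ∘ suc) g n)) (⋆-cong {g = g} ∂-shift (λ _ → refl) n)) ⟩
    (1ℚ * f 1 * g (suc n) + ((∂ f ∘ suc) ⋆ g) n) + (f 0 * (i₂ * g₂) + (f′ ⋆ ∂ g) n) ∎
    where
    open ≡-Reasoning
    f′ : ℕ → ℚ
    f′ = f ∘ suc
    i₁ i₂ g₂ : ℚ
    i₁ = ι (suc n)
    i₂ = ι (suc (suc n))
    g₂ = g (suc (suc n))
    ∂-shift : ∀ j → ∂ f′ j + f′ (suc j) ≡ ∂ f (suc j)
    ∂-shift j = trans (solve 2 (λ i a → i :* a :+ a := (i :+ con 1ℚ) :* a) refl (ι (suc j)) (f (suc (suc j))))
                  (cong (_* f (suc (suc j))) (sym (ι-suc (suc j))))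

  mercator-inverse : ∀ j → mercator (suc j) * ι (suc j) ≡ 1ℚ
  mercator-inverse j = trans
    (cong (_* ι (suc j)) (/-cong {ℤ.+ 1} {suc j} {ℤ.+ 1} {suc j ℕ.* 1} refl (sym (ℕ.*-identityʳ (suc j)))))
    (unitFraction-* (suc j) 1)

  0≤mercator : NonNeg mercator
  0≤mercator zero    = ≤-refl
  0≤mercator (suc j) = nonNegative⁻¹ (mercator (suc j)) ⦃ normalize-nonNeg 1 (suc j) ⦄

  mercator-cancel : ∀ j p → mercator (suc j) * (ι (suc j) * p) ≡ p
  mercator-cancel j p = trans (sym (*-assoc (mercator (suc j)) (ι (suc j)) p))
    (trans (cong (_* p) (mercator-inverse j)) (*-identityˡ p))

  -- As `∂ f j` unfolds to `ι (suc j) * f (suc j)`, this recovers a coefficient of positive degree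
  -- from the derivative.
  ι-cancel : ∀ j {p q} → ι (suc j) * p ≡ ι (suc j) * q → p ≡ q
  ι-cancel j {p} {q} eq = trans (sym (mercator-cancel j p))
    (trans (cong (mercator (suc j) *_) eq) (mercator-cancel j q))

  ι-mercator : ∀ j p → ι (suc j) * (mercator (suc j) * p) ≡ p
  ι-mercator j p = trans (solve 3 (λ i m p → i :* (m :* p) := m :* (i :* p)) refl (ι (suc j)) (mercator (suc j)) p)
    (mercator-cancel j p)

  -- The exponential series

  expTerm : ℚ → ℕ → ℚ
  expTerm y j = (1/! j) * y ^ j

  ∂-expTerm : ∀ y j → ∂ (expTerm y) j ≡ y * expTerm y j
  ∂-expTerm y j = trans
    (solve 4 (λ i e y p → i :* (e :* (y :* p)) := e :* i :* (y :* p)) refl (ι (suc j)) (1/! suc j) y (y ^ j))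
    (trans (cong (_* (y * y ^ j)) (1/!-suc j))
      (solve 3 (λ e y p → e :* (y :* p) := y :* (e :* p)) refl (1/! j) y (y ^ j)))

  -- Read as series in a formal variable, both sides have constant term 1 and satisfy h' = (x + y)
  -- h, which determines every coefficient.
  expTerm-⋆ : ∀ x y n → (expTerm x ⋆ expTerm y) n ≡ expTerm (x + y) n
  expTerm-⋆ x y zero    = refl
  expTerm-⋆ x y (suc n) = ι-cancel n (begin
    ∂ (expTerm x ⋆ expTerm y) n
      ≡⟨ ∂-⋆ (expTerm x) (expTerm y) n ⟩
    (∂ (expTerm x) ⋆ expTerm y) n + (expTerm x ⋆ ∂ (expTerm y)) n
      ≡⟨ cong₂ _+_
           (trans (⋆-cong {g = expTerm y} (∂-expTerm x) (λ _ → refl) n) (⋆-*ˡ x (expTerm x) (expTerm y) n))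
           (trans (⋆-cong {f = expTerm x} (λ _ → refl) (∂-expTerm y) n) (⋆-*ʳ y (expTerm x) (expTerm y) n)) ⟩
    x * (expTerm x ⋆ expTerm y) n + y * (expTerm x ⋆ expTerm y) n
      ≡⟨ *-distribʳ-+ ((expTerm x ⋆ expTerm y) n) x y ⟨
    (x + y) * (expTerm x ⋆ expTerm y) n
      ≡⟨ cong ((x + y) *_) (expTerm-⋆ x y n) ⟩
    (x + y) * expTerm (x + y) n
      ≡⟨ ∂-expTerm (x + y) n ⟨
    ∂ (expTerm (x + y)) n ∎)
    where open ≡-Reasoning

  ∣expTerm∣ : ∀ y j → ∣ expTerm y j ∣ ≡ expTerm ∣ y ∣ j
  ∣expTerm∣ y j = trans (∣p*q∣≡∣p∣*∣q∣ (1/! j) (y ^ j)) (cong₂ _*_ (0≤p⇒∣p∣≡p (1/!-nonneg j)) (∣^∣ y j))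

  expTerm-nonneg : ∀ {y} → 0ℚ ≤ y → NonNeg (expTerm y)
  expTerm-nonneg 0≤y j = *-nonneg (1/!-nonneg j) (^-nonneg 0≤y j)

  -- The right side is a stretch of the exponential series at |x| + |y| from index `n` on, hence
  -- uniformly small for bounded arguments.
  exp-defect : ∀ x y n → ∣ eval 1/!_ n x * eval 1/!_ n y - eval 1/!_ n (x + y) ∣ ≤
               eval 1/!_ (n ℕ.+ n) (∣ x ∣ + ∣ y ∣) - eval 1/!_ n (∣ x ∣ + ∣ y ∣)
  exp-defect x y n = begin
    ∣ eval 1/!_ n x * eval 1/!_ n y - eval 1/!_ n (x + y) ∣
      ≡⟨ cong (λ s → ∣ eval 1/!_ n x * eval 1/!_ n y - s ∣) (partialSum-cong (expTerm-⋆ x y) n) ⟨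
    ∣ defect (expTerm x) (expTerm y) n ∣
      ≤⟨ ∣defect∣≤ (expTerm x) (expTerm y) n ⟩
    defect (∣_∣ ∘ expTerm x) (∣_∣ ∘ expTerm y) n
      ≡⟨ cong₂ _-_ (cong₂ _*_ (partialSum-cong (∣expTerm∣ x) n) (partialSum-cong (∣expTerm∣ y) n))
           (partialSum-cong (λ j → trans (⋆-cong (∣expTerm∣ x) (∣expTerm∣ y) j) (expTerm-⋆ ∣ x ∣ ∣ y ∣ j)) n) ⟩
    eval 1/!_ n ∣ x ∣ * eval 1/!_ n ∣ y ∣ - eval 1/!_ n (∣ x ∣ + ∣ y ∣)
      ≤⟨ +-monoˡ-≤ (- eval 1/!_ n (∣ x ∣ + ∣ y ∣))
           (partialSum-*-≤ (expTerm-nonneg (0≤∣p∣ x)) (expTerm-nonneg (0≤∣p∣ y)) n n) ⟩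
    partialSum (expTerm ∣ x ∣ ⋆ expTerm ∣ y ∣) (n ℕ.+ n) - eval 1/!_ n (∣ x ∣ + ∣ y ∣)
      ≡⟨ cong (_- eval 1/!_ n (∣ x ∣ + ∣ y ∣)) (partialSum-cong (expTerm-⋆ ∣ x ∣ ∣ y ∣) (n ℕ.+ n)) ⟩
    eval 1/!_ (n ℕ.+ n) (∣ x ∣ + ∣ y ∣) - eval 1/!_ n (∣ x ∣ + ∣ y ∣) ∎
    where open ≤-Reasoning

  eval-exp-0 : ∀ n → eval 1/!_ (suc n) 0ℚ ≡ 1ℚ
  eval-exp-0 zero    = refl
  eval-exp-0 (suc n) = trans (cong₂ _+_ (eval-exp-0 n)
    (solve 2 (λ e p → e :* (con 0ℚ :* p) := con 0ℚ) refl (1/! suc n) (0ℚ ^ n))) (+-identityʳ 1ℚ)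

  -- Powers of the logarithm

  -- The coefficients of (- log (1 - u))ᵏ / k!, integrated termwise from
  -- d/du (- log (1 - u))ᵏ⁺¹ / (k+1)! = (- log (1 - u))ᵏ / k! · 1 / (1 - u).
  logPower : ℕ → ℕ → ℚ
  logPower zero    zero    = 1ℚ
  logPower zero    (suc j) = 0ℚ
  logPower (suc k) zero    = 0ℚ
  logPower (suc k) (suc j) = mercator (suc j) * partialSum (logPower k) (suc j)

  0≤logPower : ∀ k → NonNeg (logPower k)
  0≤logPower zero    zero    = 0≤1
  0≤logPower zero    (suc j) = ≤-refl
  0≤logPower (suc k) zero    = ≤-refl
  0≤logPower (suc k) (suc j) = *-nonneg (0≤mercator (suc j)) (partialSum-nonneg (0≤logPower k) (suc j))

  -- With L = - log (1 - u) this is L (L^k / k!) = (k + 1) L^(k+1) / (k + 1)!, which links the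
  -- termwise integrals to actual powers of `mercator`. The constant terms vanish, and the
  -- derivatives agree by the Leibniz rule and induction on `k`.
  mercator-⋆-logPower : ∀ k n → (mercator ⋆ logPower k) n ≡ ι (suc k) * logPower (suc k) n
  mercator-⋆-logPower k zero    = trans (*-zeroˡ (logPower k 0)) (sym (*-zeroʳ (ι (suc k))))
  mercator-⋆-logPower k (suc n) = ι-cancel n (begin
    ∂ (mercator ⋆ logPower k) n
      ≡⟨ ∂-⋆ mercator (logPower k) n ⟩
    (∂ mercator ⋆ logPower k) n + (mercator ⋆ ∂ (logPower k)) n
      ≡⟨ cong₂ _+_
           (trans (⋆-cong {g = logPower k} (λ j → trans (*-comm (ι (suc j)) (mercator (suc j))) (mercator-inverse j)) (λ _ → refl) n)
             (⋆-1ˡ (logPower k) n))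
           (lower k) ⟩
    partialSum (logPower k) (suc n) + ι k * partialSum (logPower k) (suc n)
      ≡⟨ solve 2 (λ s i → s :+ i :* s := (i :+ con 1ℚ) :* s) refl (partialSum (logPower k) (suc n)) (ι k) ⟩
    (ι k + 1ℚ) * partialSum (logPower k) (suc n)
      ≡⟨ cong₂ _*_ (sym (ι-suc k)) (sym (ι-mercator n (partialSum (logPower k) (suc n)))) ⟩
    ι (suc k) * (ι (suc n) * logPower (suc k) (suc n))
      ≡⟨ solve 3 (λ a b c → a :* (b :* c) := b :* (a :* c)) refl (ι (suc k)) (ι (suc n)) (logPower (suc k) (suc n)) ⟩
    ι (suc n) * (ι (suc k) * logPower (suc k) (suc n)) ∎)
    where
    open ≡-Reasoning
    lower : ∀ k → (mercator ⋆ ∂ (logPower k)) n ≡ ι k * partialSum (logPower k) (suc n)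
    lower zero    = trans (⋆-cong {f = mercator} (λ _ → refl) (λ j → *-zeroʳ (ι (suc j))) n)
      (trans (⋆-zeroʳ mercator n) (sym (*-zeroˡ (partialSum (logPower 0) (suc n)))))
    -- The derivative of L^(k+1) / (k + 1)! is L^k / k! times 1/(1 - u); the last factor moves
    -- outside the product and leaves the claim for `k`.
    lower (suc k) = begin
      (mercator ⋆ ∂ (logPower (suc k))) n
        ≡⟨ ⋆-cong {f = mercator} (λ _ → refl) (λ j → ι-mercator j (partialSum (logPower k) (suc j))) n ⟩
      (mercator ⋆ (λ j → partialSum (logPower k) (suc j))) n
        ≡⟨ ⋆-partialSum mercator (logPower k) n ⟩
      partialSum (mercator ⋆ logPower k) (suc n)
        ≡⟨ partialSum-cong (mercator-⋆-logPower k) (suc n) ⟩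
      partialSum (λ j → ι (suc k) * logPower (suc k) j) (suc n)
        ≡⟨ partialSum-* (ι (suc k)) (logPower (suc k)) (suc n) ⟩
      ι (suc k) * partialSum (logPower (suc k)) (suc n) ∎

  -- The coefficient of u^j in the first `K` terms of exp (c L), a truncation of (1 - u)^(-c), where
  -- L = - log (1 - u).
  expLog : ℚ → ℕ → ℕ → ℚ
  expLog c K j = partialSum (λ k → c ^ k * logPower k j) K

  expLog-zero : ∀ c K → expLog c (suc K) 0 ≡ 1ℚ
  expLog-zero c K = trans (partialSum-head (λ k → c ^ k * logPower k 0) K)
    (cong (1ℚ +_) (trans (partialSum-cong (λ k → *-zeroʳ (c ^ suc k)) K) (partialSum-0 K)))

  -- Termwise integration of (exp (c L))' = c exp (c L) / (1 - u); differentiation lowers the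
  -- truncation by one.
  expLog-suc : ∀ c K j → expLog c (suc K) (suc j) ≡ c * (mercator (suc j) * partialSum (expLog c K) (suc j))
  expLog-suc c K j = begin
    expLog c (suc K) (suc j)
      ≡⟨ partialSum-head (λ k → c ^ k * logPower k (suc j)) K ⟩
    0ℚ + partialSum (λ k → c * c ^ k * (m * partialSum (logPower k) (suc j))) K
      ≡⟨ +-identityˡ _ ⟩
    partialSum (λ k → c * c ^ k * (m * partialSum (logPower k) (suc j))) K
      ≡⟨ partialSum-cong (λ k → trans
           (solve 4 (λ c p m s → c :* p :* (m :* s) := c :* m :* (p :* s)) refl c (c ^ k) m (partialSum (logPower k) (suc j)))
           (cong (c * m *_) (sym (partialSum-* (c ^ k) (logPower k) (suc j))))) K ⟩
    partialSum (λ k → c * m * partialSum (λ i → c ^ k * logPower k i) (suc j)) K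
      ≡⟨ partialSum-* (c * m) (λ k → partialSum (λ i → c ^ k * logPower k i) (suc j)) K ⟩
    c * m * partialSum (λ k → partialSum (λ i → c ^ k * logPower k i) (suc j)) K
      ≡⟨ cong (c * m *_) (partialSum-swap (λ k i → c ^ k * logPower k i) K (suc j)) ⟩
    c * m * partialSum (expLog c K) (suc j)
      ≡⟨ *-assoc c m _ ⟩
    c * (m * partialSum (expLog c K) (suc j)) ∎
    where
    open ≡-Reasoning
    m : ℚ
    m = mercator (suc j)

  -- The case c = 1 truncates 1/(1 - u). By `expLog-suc` a coefficient is the average of those of
  -- lower degree at the next smaller truncation.
  expLog-1≤1 : ∀ K j → expLog 1ℚ K j ≤ 1ℚ
  expLog-1≤1 zero    j       = 0≤1
  expLog-1≤1 (suc K) zero    = ≤-reflexive (expLog-zero 1ℚ K)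
  expLog-1≤1 (suc K) (suc j) = begin
    expLog 1ℚ (suc K) (suc j)
      ≡⟨ trans (expLog-suc 1ℚ K j) (*-identityˡ _) ⟩
    mercator (suc j) * partialSum (expLog 1ℚ K) (suc j)
      ≤⟨ *-monoˡ (0≤mercator (suc j)) (partialSum-mono (suc j) (λ i _ → expLog-1≤1 K i)) ⟩
    mercator (suc j) * partialSum (λ _ → 1ℚ) (suc j)
      ≡⟨ cong (mercator (suc j) *_) (partialSum-1 (suc j)) ⟩
    mercator (suc j) * ι (suc j)
      ≡⟨ mercator-inverse j ⟩
    1ℚ ∎
    where open ≤-Reasoning

  1-u : ℕ → ℚ
  1-u 0             = 1ℚ
  1-u 1             = - 1ℚ
  1-u (suc (suc j)) = 0ℚ

  partialSum-1-u : ∀ j → partialSum 1-u (suc (suc j)) ≡ 0ℚ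
  partialSum-1-u zero    = refl
  partialSum-1-u (suc j) = trans (+-identityʳ _) (partialSum-1-u j)

  -- For K > j the truncation loses nothing, as L^k starts in degree k. The next coefficient is -
  -- (c_0 + ... + c_j) / (j + 1): this is -1 for j = 0, and 0 afterwards because 1 - 1 = 0.
  expLog-neg1 : ∀ K j → j ℕ.< K → expLog (- 1ℚ) K j ≡ 1-u j
  expLog-neg1 (suc K) zero    _           = expLog-zero (- 1ℚ) K
  expLog-neg1 (suc K) (suc j) (ℕ.s≤s j<K) = begin
    expLog (- 1ℚ) (suc K) (suc j)
      ≡⟨ expLog-suc (- 1ℚ) K j ⟩
    - 1ℚ * (mercator (suc j) * partialSum (expLog (- 1ℚ) K) (suc j))
      ≡⟨ cong (λ s → - 1ℚ * (mercator (suc j) * s))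
           (partialSum-cong-< (suc j) (λ i i<1+j → expLog-neg1 K i (ℕ.<-≤-trans i<1+j j<K))) ⟩
    - 1ℚ * (mercator (suc j) * partialSum 1-u (suc j))
      ≡⟨ last j ⟩
    1-u (suc j) ∎
    where
    open ≡-Reasoning
    last : ∀ j → - 1ℚ * (mercator (suc j) * partialSum 1-u (suc j)) ≡ 1-u (suc j)
    last zero    = refl
    last (suc j) = trans (cong (λ s → - 1ℚ * (mercator (suc (suc j)) * s)) (partialSum-1-u j))
      (trans (cong (- 1ℚ *_) (*-zeroʳ (mercator (suc (suc j))))) (*-zeroʳ (- 1ℚ)))

  eval-1-u : ∀ u n → eval 1-u (suc (suc n)) u ≡ 1ℚ - u
  eval-1-u u zero    = solve 1 (λ u → con 0ℚ :+ con 1ℚ :* con 1ℚ :+ con (- 1ℚ) :* (u :* con 1ℚ) := con 1ℚ :- u) refl u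
  eval-1-u u (suc n) = trans (cong (eval 1-u (suc (suc n)) u +_) (*-zeroˡ (u ^ suc (suc n))))
    (trans (+-identityʳ _) (eval-1-u u n))

  eval-expLog : ∀ c u K N → partialSum (λ k → c ^ k * eval (logPower k) N u) K ≡ eval (expLog c K) N u
  eval-expLog c u K N = begin
    partialSum (λ k → c ^ k * eval (logPower k) N u) K
      ≡⟨ partialSum-cong (λ k → sym (partialSum-* (c ^ k) (λ j → logPower k j * u ^ j) N)) K ⟩
    partialSum (λ k → partialSum (λ j → c ^ k * (logPower k j * u ^ j)) N) K
      ≡⟨ partialSum-swap (λ k j → c ^ k * (logPower k j * u ^ j)) K N ⟩
    partialSum (λ j → partialSum (λ k → c ^ k * (logPower k j * u ^ j)) K) N
      ≡⟨ partialSum-cong (λ j → trans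
           (partialSum-cong (λ k → solve 3 (λ a b c → a :* (b :* c) := c :* (a :* b)) refl (c ^ k) (logPower k j) (u ^ j)) K)
           (trans (partialSum-* (u ^ j) (λ k → c ^ k * logPower k j) K) (*-comm (u ^ j) (expLog c K j)))) N ⟩
    eval (expLog c K) N u ∎
    where open ≡-Reasoning

  1^ : ∀ k → 1ℚ ^ k ≡ 1ℚ
  1^ zero    = refl
  1^ (suc k) = trans (*-identityˡ _) (1^ k)

  module ExpLog {u : ℚ} (0≤u : 0ℚ ≤ u) (n : ℕ) where

    m : ℚ
    m = eval mercator n u

    terms-nonneg : ∀ {a} → NonNeg a → NonNeg (λ j → a j * u ^ j)
    terms-nonneg 0≤a j = *-nonneg (0≤a j) (^-nonneg 0≤u j)

    0≤m : 0ℚ ≤ m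
    0≤m = partialSum-nonneg (terms-nonneg 0≤mercator) n

    expTerm-suc : ∀ k → expTerm m (suc k) ≡ mercator (suc k) * (m * expTerm m k)
    expTerm-suc k = ι-cancel k (trans (∂-expTerm m k) (sym (ι-mercator k (m * expTerm m k))))

    -- The analogue of `expTerm-suc`, with a partial sum of a Cauchy product in place of a product.
    -- `lower` and `upper` compare the two recursions.
    eval-logPower-suc : ∀ k N → eval (logPower (suc k)) N u ≡
      mercator (suc k) * partialSum ((λ j → mercator j * u ^ j) ⋆ (λ j → logPower k j * u ^ j)) N
    eval-logPower-suc k N = sym (begin
      mercator (suc k) * partialSum ((λ j → mercator j * u ^ j) ⋆ (λ j → logPower k j * u ^ j)) N
        ≡⟨ cong (mercator (suc k) *_) (trans (partialSum-cong (λ j → trans (⋆-scale mercator (logPower k) u j)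
             (trans (cong (_* u ^ j) (mercator-⋆-logPower k j)) (*-assoc (ι (suc k)) (logPower (suc k) j) (u ^ j)))) N)
             (partialSum-* (ι (suc k)) (λ j → logPower (suc k) j * u ^ j) N)) ⟩
      mercator (suc k) * (ι (suc k) * eval (logPower (suc k)) N u)
        ≡⟨ mercator-cancel k (eval (logPower (suc k)) N u) ⟩
      eval (logPower (suc k)) N u ∎)
      where open ≡-Reasoning

    eval-logPower-0 : ∀ N → eval (logPower 0) N u ≤ 1ℚ
    eval-logPower-0 zero          = 0≤1
    eval-logPower-0 (suc zero)    = ≤-refl
    eval-logPower-0 (suc (suc N)) = ≤-trans
      (≤-reflexive (trans (cong (eval (logPower 0) (suc N) u +_) (*-zeroˡ (u ^ suc N))) (+-identityʳ _)))
      (eval-logPower-0 (suc N))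

    -- Each factor `m` replaces a triangle of nonnegative terms by the square around it.
    lower : ∀ k → eval (logPower k) n u ≤ expTerm m k
    lower zero    = eval-logPower-0 n
    lower (suc k) = begin
      eval (logPower (suc k)) n u
        ≡⟨ eval-logPower-suc k n ⟩
      mercator (suc k) * partialSum ((λ j → mercator j * u ^ j) ⋆ (λ j → logPower k j * u ^ j)) n
        ≤⟨ *-monoˡ (0≤mercator (suc k)) (≤-trans
             (partialSum-⋆-≤ (terms-nonneg 0≤mercator) (terms-nonneg (0≤logPower k)) n)
             (*-monoˡ 0≤m (lower k))) ⟩
      mercator (suc k) * (m * expTerm m k)
        ≡⟨ expTerm-suc k ⟨
      expTerm m (suc k) ∎
      where open ≤-Reasoning

    -- Each factor `m` has `n` terms, so the rectangle it spans fits in a triangle longer by `n`;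
    -- the 1 accounts for the constant series at k = 0.
    upper : ∀ k → expTerm m k ≤ eval (logPower k) (k ℕ.* n ℕ.+ 1) u
    upper zero    = ≤-refl
    upper (suc k) = begin
      expTerm m (suc k)
        ≡⟨ expTerm-suc k ⟩
      mercator (suc k) * (m * expTerm m k)
        ≤⟨ *-monoˡ (0≤mercator (suc k)) (≤-trans (*-monoˡ 0≤m (upper k))
             (partialSum-*-≤ (terms-nonneg 0≤mercator) (terms-nonneg (0≤logPower k)) n (k ℕ.* n ℕ.+ 1))) ⟩
      mercator (suc k) * partialSum ((λ j → mercator j * u ^ j) ⋆ (λ j → logPower k j * u ^ j)) (n ℕ.+ (k ℕ.* n ℕ.+ 1))
        ≡⟨ eval-logPower-suc k (n ℕ.+ (k ℕ.* n ℕ.+ 1)) ⟨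
      eval (logPower (suc k)) (n ℕ.+ (k ℕ.* n ℕ.+ 1)) u
        ≡⟨ cong (λ N → eval (logPower (suc k)) N u) (ℕ.+-assoc n (k ℕ.* n) 1) ⟨
      eval (logPower (suc k)) (suc k ℕ.* n ℕ.+ 1) u ∎
      where open ≤-Reasoning

    -- One length that covers `k * n + 1` for all k < n.
    N : ℕ
    N = n ℕ.* n ℕ.+ 1

    n≤N : n ℕ.≤ N
    n≤N = ℕ.≤-trans (m≤m*m n) (ℕ.m≤m+n (n ℕ.* n) 1)
      where
      m≤m*m : ∀ n → n ℕ.≤ n ℕ.* n
      m≤m*m zero    = ℕ.z≤n
      m≤m*m (suc n) = ℕ.m≤m*n (suc n) (suc n)

    upper-N : ∀ k → k ℕ.< n → expTerm m k ≤ eval (logPower k) N u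
    upper-N k k<n = ≤-trans (upper k) (partialSum-mono-≤ (terms-nonneg (0≤logPower k))
      (ℕ.+-monoˡ-≤ 1 (ℕ.*-monoˡ-≤ n (ℕ.<⇒≤ k<n))))

    eval-exp-neg : eval 1/!_ n (- m) ≡ partialSum (λ k → (- 1ℚ) ^ k * expTerm m k) n
    eval-exp-neg = partialSum-cong (λ k → trans
      (cong (λ z → (1/! k) * z ^ k) (solve 1 (λ m → :- m := con (- 1ℚ) :* m) refl m))
      (trans (cong ((1/! k) *_) (^-distrib-* (- 1ℚ) m k))
        (solve 3 (λ a b c → a :* (b :* c) := b :* (a :* c)) refl (1/! k) ((- 1ℚ) ^ k) (m ^ k)))) n

    excess : ℕ → ℚ
    excess k = expTerm m k - eval (logPower k) n u

    ∣±excess∣ : ∀ k → ∣ (- 1ℚ) ^ k * excess k ∣ ≡ excess k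
    ∣±excess∣ k = trans (∣p*q∣≡∣p∣*∣q∣ ((- 1ℚ) ^ k) (excess k))
      (trans (cong₂ _*_ (trans (∣^∣ (- 1ℚ) k) (1^ k)) (0≤p⇒∣p∣≡p (≤⇒0≤- (lower k)))) (*-identityˡ _))

    sum-eval-logPower : ∀ N → partialSum (λ k → eval (logPower k) N u) n ≡ eval (expLog 1ℚ n) N u
    sum-eval-logPower N = trans
      (partialSum-cong (λ k → sym (trans (cong (_* eval (logPower k) N u) (1^ k)) (*-identityˡ _))) n)
      (eval-expLog 1ℚ u n N)

    -- By `expLog-1≤1` the series of 1/(1 - u) minus `expLog 1ℚ n` has nonnegative terms, so its
    -- partial sums grow with the length.
    tail-≤ : eval (expLog 1ℚ n) N u - eval (expLog 1ℚ n) n u ≤ eval (λ _ → 1ℚ) N u - eval (λ _ → 1ℚ) n u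
    tail-≤ = 0≤-⇒≤ (≤-trans (≤⇒0≤- (partialSum-mono-≤ 0≤gap n≤N)) (≤-reflexive (trans
      (cong₂ _-_ (partialSum-- one row N) (partialSum-- one row n))
      (solve 4 (λ A B C D → (A :- B) :- (C :- D) := (A :- C) :- (B :- D)) refl
        (partialSum one N) (partialSum row N) (partialSum one n) (partialSum row n)))))
      where
      one row : ℕ → ℚ
      one j = 1ℚ * u ^ j
      row j = expLog 1ℚ n j * u ^ j
      0≤gap : NonNeg (λ j → one j - row j)
      0≤gap j = ≤⇒0≤- (*-monoʳ (^-nonneg 0≤u j) (expLog-1≤1 n j))

    exp-log-error : 2 ℕ.≤ n → ∣ eval 1/!_ n (- m) - (1ℚ - u) ∣ ≤ eval (λ _ → 1ℚ) N u - eval (λ _ → 1ℚ) n u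
    exp-log-error 2≤n = begin
      ∣ eval 1/!_ n (- m) - (1ℚ - u) ∣
        -- By `signed`, the powers of the logarithm cut off at degree `n` already reproduce 1 - u
        -- exactly.
        ≡⟨ cong ∣_∣ (cong₂ _-_ eval-exp-neg (sym signed)) ⟩
      ∣ partialSum (λ k → (- 1ℚ) ^ k * expTerm m k) n - partialSum (λ k → (- 1ℚ) ^ k * eval (logPower k) n u) n ∣
        ≡⟨ cong ∣_∣ (trans (sym (partialSum-- (λ k → (- 1ℚ) ^ k * expTerm m k) (λ k → (- 1ℚ) ^ k * eval (logPower k) n u) n))
             (partialSum-cong (λ k → solve 3 (λ a b c → a :* b :- a :* c := a :* (b :- c)) refl
               ((- 1ℚ) ^ k) (expTerm m k) (eval (logPower k) n u)) n)) ⟩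
      ∣ partialSum (λ k → (- 1ℚ) ^ k * excess k) n ∣
        -- Each `excess` is nonnegative, so absolute values just remove the signs: this passes from
        -- c = -1 to c = 1.
        ≤⟨ partialSum-∣∣ (λ k → (- 1ℚ) ^ k * excess k) n ⟩
      partialSum (λ k → ∣ (- 1ℚ) ^ k * excess k ∣) n
        ≡⟨ partialSum-cong ∣±excess∣ n ⟩
      partialSum excess n
        ≤⟨ partialSum-mono n (λ k k<n → +-monoˡ-≤ (- eval (logPower k) n u) (upper-N k k<n)) ⟩
      partialSum (λ k → eval (logPower k) N u - eval (logPower k) n u) n
        ≡⟨ partialSum-- (λ k → eval (logPower k) N u) (λ k → eval (logPower k) n u) n ⟩
      partialSum (λ k → eval (logPower k) N u) n - partialSum (λ k → eval (logPower k) n u) n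
        ≡⟨ cong₂ _-_ (sum-eval-logPower N) (sum-eval-logPower n) ⟩
      eval (expLog 1ℚ n) N u - eval (expLog 1ℚ n) n u
        ≤⟨ tail-≤ ⟩
      eval (λ _ → 1ℚ) N u - eval (λ _ → 1ℚ) n u ∎
      where
      open ≤-Reasoning
      -- Two terms are required to see both coefficients of 1 - u.
      eval-1-u-≥2 : ∀ {n} → 2 ℕ.≤ n → eval 1-u n u ≡ 1ℚ - u
      eval-1-u-≥2 {suc (suc n)} _              = eval-1-u u n
      eval-1-u-≥2 {suc zero}    (ℕ.s≤s ())
      signed : partialSum (λ k → (- 1ℚ) ^ k * eval (logPower k) n u) n ≡ 1ℚ - u
      signed = trans (eval-expLog (- 1ℚ) u n n)
        (trans (partialSum-cong-< n (λ j j<n → cong (_* u ^ j) (expLog-neg1 n j j<n))) (eval-1-u-≥2 2≤n))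

  -- Error bounds uniform in the argument.

  geometricBound : ∀ {r} → 0ℚ ≤ r → r < 1ℚ → GeometricBound (λ _ → 1ℚ) r
  geometricBound {r} 0≤r r<1 = record
    { C = 1ℚ ; ρ = r ; 0≤C = 0≤1 ; 0≤ρ = 0≤r ; ρ<1 = r<1 ; bound = λ _ → ≤-refl ; bound′ = λ _ → ≤-refl }

  -- The rank `A` depends on `r` and `ε` only, so `x` and `y` may vary with `n`, as the
  -- approximations of two reals do.
  exp-+-close : ∀ {r} → 0ℚ ≤ r → ∀ {ε} → 0ℚ < ε → ∃ λ A → ∀ {n x y} → A ℕ.≤ n → ∣ x ∣ + ∣ y ∣ ≤ r →
    ∣ eval 1/!_ n x * eval 1/!_ n y - eval 1/!_ n (x + y) ∣ < ε
  exp-+-close {r} 0≤r {ε} 0<ε =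
    let (A , small) = decay (C * g) 0≤Cg 0<ε in
    A , λ {n} {x} {y} A≤n x+y≤r → begin-strict
      ∣ eval 1/!_ n x * eval 1/!_ n y - eval 1/!_ n (x + y) ∣
        ≤⟨ exp-defect x y n ⟩
      eval 1/!_ (n ℕ.+ n) (∣ x ∣ + ∣ y ∣) - eval 1/!_ n (∣ x ∣ + ∣ y ∣)
        ≤⟨ p≤∣p∣ _ ⟩
      ∣ eval 1/!_ (n ℕ.+ n) (∣ x ∣ + ∣ y ∣) - eval 1/!_ n (∣ x ∣ + ∣ y ∣) ∣
        ≤⟨ eval-tail {∣ x ∣ + ∣ y ∣} (≤-trans (≤-reflexive (0≤p⇒∣p∣≡p (+-mono-≤ (0≤∣p∣ x) (0≤∣p∣ y)))) x+y≤r)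
             (ℕ.m≤m+n n n) ⟩
      C * g * ρ ^ n
        <⟨ small n A≤n ⟩
      ε ∎
    where
    open GeometricBound (expBound r 0≤r)
    open Geometric 0≤ρ ρ<1
    open ≤-Reasoning

  exp-log-close : ∀ {r} → 0ℚ ≤ r → r < 1ℚ → ∀ {ε} → 0ℚ < ε → ∃ λ A → ∀ {n u} → A ℕ.≤ n → 0ℚ ≤ u → u ≤ r →
    ∣ eval 1/!_ n (- eval mercator n u) - (1ℚ - u) ∣ < ε
  exp-log-close {r} 0≤r r<1 {ε} 0<ε =
    let (A , small) = decay (C * g) 0≤Cg 0<ε in
    -- The 2 supplies the hypothesis of `exp-log-error`.
    2 ℕ.+ A , λ {n} {u} A≤n 0≤u u≤r → begin-strict
      ∣ eval 1/!_ n (- eval mercator n u) - (1ℚ - u) ∣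
        ≤⟨ ExpLog.exp-log-error 0≤u n (ℕ.≤-trans (ℕ.m≤m+n 2 A) A≤n) ⟩
      eval (λ _ → 1ℚ) (n ℕ.* n ℕ.+ 1) u - eval (λ _ → 1ℚ) n u
        ≤⟨ p≤∣p∣ _ ⟩
      ∣ eval (λ _ → 1ℚ) (n ℕ.* n ℕ.+ 1) u - eval (λ _ → 1ℚ) n u ∣
        ≤⟨ eval-tail {u} (≤-trans (≤-reflexive (0≤p⇒∣p∣≡p 0≤u)) u≤r) (ExpLog.n≤N 0≤u n) ⟩
      C * g * ρ ^ n
        <⟨ small n (ℕ.≤-trans (ℕ.m≤n+m A 2) A≤n) ⟩
      ε ∎
    where
    open GeometricBound (geometricBound 0≤r r<1)
    open Geometric 0≤ρ ρ<1
    open ≤-Reasoning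

-- Binomial coefficients.

module BinomialCoefficients where
  open import Data.Nat using (_+_; _*_)
  open import Data.Nat.Solver using (module +-*-Solver)
  open +-*-Solver
  open ≡-Reasoning

  C-factorial : ∀ k d → ((k + d) C k) * (k ! * d !) ≡ (k + d) !
  C-factorial k d = begin
    ((k + d) C k) * (k ! * d !)
      ≡⟨ cong (λ e → ((k + d) C k) * (k ! * e !)) (ℕ.m+n∸m≡n k d) ⟨
    ((k + d) C k) * (k ! * (k + d ∸ k) !)
      ≡⟨ cong (_* (k ! * (k + d ∸ k) !)) (nCk≡n!/k![n-k]! k≤k+d) ⟩
    ((k + d) ! ℕ./ (k ! * (k + d ∸ k) !)) * (k ! * (k + d ∸ k) !)
      ≡⟨ ℕ.m/n*n≡m (k![n∸k]!∣n! k≤k+d) ⟩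
    (k + d) ! ∎
    where
    k≤k+d : k ℕ.≤ k + d
    k≤k+d = ℕ.m≤m+n k d
    instance _ = k ℕ.!* (k + d ∸ k) !≢0

  -- Multiplied by k! t! s!, both sides become (k + t + s)!. Taking i = k + t and n = k + t + s
  -- avoids subtraction.
  C-C : ∀ k t s → ((k + t) C k) * ((k + (t + s)) C (k + t)) ≡ ((k + (t + s)) C k) * ((t + s) C t)
  C-C k t s = ℕ.*-cancelʳ-≡ _ _ (k ! * (t ! * s !)) (begin
    a * b * (k ! * (t ! * s !))
      ≡⟨ solve 5 (λ a b x y z → a :* b :* (x :* (y :* z)) := b :* (a :* (x :* y) :* z)) refl a b (k !) (t !) (s !) ⟩
    b * (a * (k ! * t !) * s !)
      ≡⟨ cong (λ e → b * (e * s !)) (C-factorial k t) ⟩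
    b * ((k + t) ! * s !)
      ≡⟨ cong (λ e → (e C (k + t)) * ((k + t) ! * s !)) (ℕ.+-assoc k t s) ⟨
    ((k + t + s) C (k + t)) * ((k + t) ! * s !)
      ≡⟨ C-factorial (k + t) s ⟩
    (k + t + s) !
      ≡⟨ cong _! (ℕ.+-assoc k t s) ⟩
    (k + (t + s)) !
      ≡⟨ C-factorial k (t + s) ⟨
    c * (k ! * (t + s) !)
      ≡⟨ cong (λ e → c * (k ! * e)) (C-factorial t s) ⟨
    c * (k ! * (d * (t ! * s !)))
      ≡⟨ solve 5 (λ c d x y z → c :* (x :* (d :* (y :* z))) := c :* d :* (x :* (y :* z))) refl c d (k !) (t !) (s !) ⟩
    c * d * (k ! * (t ! * s !)) ∎)
    where
    a b c d : ℕ
    a = (k + t) C k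
    b = (k + (t + s)) C (k + t)
    c = (k + (t + s)) C k
    d = (t + s) C t
    instance _ = ℕ.m*n≢0 (k !) (t ! * s !) ⦃ k ℕ.!≢0 ⦄ ⦃ t ℕ.!* s !≢0 ⦄

-- The expansion over an arbitrary commutative ring.

module BernsteinExpansion {c ℓ} (R : CommutativeRing c ℓ) where
  open CommutativeRing R renaming (refl to ≈-refl; sym to ≈-sym; trans to ≈-trans; reflexive to ≈-reflexive; zero to *-zero)
  open import Algebra.Properties.CommutativeSemiring.Binomial commutativeSemiring using () renaming (theorem to binomialTheorem)
  open import Algebra.Properties.CommutativeSemiring.Exp commutativeSemiring
  open import Algebra.Properties.Ring ring using (-1*x≈-x)
  open import Algebra.Properties.Semiring.Mult semiring renaming (_×_ to _·_)
  open import Algebra.Properties.Semiring.Sum semiring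
  open import Algebra.Solver.Ring.NaturalCoefficients.Default commutativeSemiring using (solve; _:*_; _:=_)
  open import Relation.Binary.Reasoning.Setoid setoid

  ∑ : ℕ → ℕ → (ℕ → Carrier) → Carrier
  ∑ k n g = sum {suc n ∸ k} (λ j → g (k ℕ.+ toℕ j))

  -- The coefficients of t^k; convolution with them selects a single term, if it is in range.
  δ : ℕ → ℕ → Carrier
  δ k i = if i ℕ.≡ᵇ k then 1# else 0#

  sum-zero : ∀ m → sum {m} (λ _ → 0#) ≈ 0#
  sum-zero zero    = ≈-refl
  sum-zero (suc m) = ≈-trans (+-identityˡ _) (sum-zero m)

  sum-δ-≥ : ∀ {m k} → m ℕ.≤ k → ∀ (h : ℕ → Carrier) → sum {m} (λ i → δ k (toℕ i) * h (toℕ i)) ≈ 0#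
  sum-δ-≥ ℕ.z≤n       h = ≈-refl
  sum-δ-≥ (ℕ.s≤s m≤k) h = ≈-trans (+-cong (zeroˡ _) (sum-δ-≥ m≤k (h ∘ suc))) (+-identityˡ 0#)

  sum-δ-< : ∀ {m k} → k ℕ.< m → ∀ (h : ℕ → Carrier) → sum {m} (λ i → δ k (toℕ i) * h (toℕ i)) ≈ h k
  sum-δ-< {suc m} {zero}  _           h = begin
    1# * h 0 + sum {m} (λ i → 0# * h (suc (toℕ i)))
      ≈⟨ +-cong (*-identityˡ _) (≈-trans (sum-cong-≋ {m} (λ i → zeroˡ _)) (sum-zero m)) ⟩
    h 0 + 0#
      ≈⟨ +-identityʳ _ ⟩
    h 0 ∎
  sum-δ-< {suc m} {suc k} (ℕ.s≤s k<m) h = ≈-trans (+-cong (zeroˡ _) (sum-δ-< k<m (h ∘ suc))) (+-identityˡ _)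

  1^n≈1 : ∀ n → 1# ^ n ≈ 1#
  1^n≈1 zero    = ≈-refl
  1^n≈1 (suc n) = ≈-trans (*-identityˡ _) (1^n≈1 n)

  -- `φ` and `f` stand for `fromℕ` and the reciprocal factorials; `φ-zero` and `φ-suc` force `φ n`
  -- to be the n-fold sum of 1.
  module _ (φ : ℕ → Carrier) (φ-zero : φ 0 ≈ 0#) (φ-suc : ∀ n → φ (suc n) ≈ φ n + 1#)
           (f : ℕ → Carrier) (f-inverse : ∀ n → f n * φ (n !) ≈ 1#) where

    ·≈φ* : ∀ n x → n · x ≈ φ n * x
    ·≈φ* zero    x = ≈-sym (≈-trans (*-congʳ φ-zero) (zeroˡ x))
    ·≈φ* (suc n) x = begin
      x + n · x          ≈⟨ +-comm x (n · x) ⟩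
      n · x + x          ≈⟨ +-cong (·≈φ* n x) (≈-sym (*-identityˡ x)) ⟩
      φ n * x + 1# * x   ≈⟨ distribʳ x (φ n) 1# ⟨
      (φ n + 1#) * x     ≈⟨ *-congʳ (φ-suc n) ⟨
      φ (suc n) * x      ∎

    φ-* : ∀ m n → φ (m ℕ.* n) ≈ φ m * φ n
    φ-* m n = begin
      φ (m ℕ.* n)            ≈⟨ φ≈·1 (m ℕ.* n) ⟩
      (m ℕ.* n) · 1#         ≈⟨ ×1-homo-* m n ⟩
      (m · 1#) * (n · 1#)    ≈⟨ *-cong (φ≈·1 m) (φ≈·1 n) ⟨
      φ m * φ n              ∎
      where
      φ≈·1 : ∀ n → φ n ≈ n · 1#
      φ≈·1 n = ≈-sym (≈-trans (·≈φ* n 1#) (*-identityʳ (φ n)))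

    -- w, ν and e stand for z^_, - 1 and the coefficients of e^{at}; they are given up to ≈ so that
    -- the conclusion can be stated with the terms that occur in the theorem.
    module _ (a b z : Carrier) (a≈1-zb : a ≈ 1# - z * b) (w : ℕ → Carrier) (w≈z^ : ∀ j → w j ≈ z ^ j)
             (ν : Carrier) (ν≈-1 : ν ≈ - 1#) (e : ℕ → Carrier) (e≈ : ∀ j → e j ≈ a ^ j * f j) where

      term : ℕ → ℕ → ℕ → Carrier
      term k n i = φ (i C k) * φ (n C i) * ν ^ (i ∸ k) * w (i ∸ k) * b ^ i

      lhs rhs : ℕ → ℕ → Carrier
      lhs k n = φ (n !) * ((b ^ k * f k) * ∑ 0 n (λ i → δ k i * e (n ∸ i)))
      rhs k n = ∑ k n (term k n)

      -- Only the index k survives the convolution with t^k, and n! = C(n,k) k! d! cancels the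
      -- reciprocals `f k` and `f d`.
      closedForm : ∀ k d → lhs k (k ℕ.+ d) ≈ φ ((k ℕ.+ d) C k) * b ^ k * a ^ d
      closedForm k d = begin
        lhs k n
          ≈⟨ *-congˡ (*-congˡ (sum-δ-< {suc n} (ℕ.s≤s (ℕ.m≤m+n k d)) (λ i → e (n ∸ i)))) ⟩
        φ (n !) * ((b ^ k * f k) * e (n ∸ k))
          ≡⟨ cong (λ j → φ (n !) * ((b ^ k * f k) * e j)) (ℕ.m+n∸m≡n k d) ⟩
        φ (n !) * ((b ^ k * f k) * e d)
          ≈⟨ *-congˡ (*-congˡ (e≈ d)) ⟩
        φ (n !) * ((b ^ k * f k) * (a ^ d * f d))
          ≡⟨ cong (λ e → φ e * ((b ^ k * f k) * (a ^ d * f d))) (BinomialCoefficients.C-factorial k d) ⟨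
        φ ((n C k) ℕ.* (k ! ℕ.* d !)) * ((b ^ k * f k) * (a ^ d * f d))
          ≈⟨ *-congʳ (≈-trans (φ-* (n C k) (k ! ℕ.* d !)) (*-congˡ (φ-* (k !) (d !)))) ⟩
        φ (n C k) * (φ (k !) * φ (d !)) * ((b ^ k * f k) * (a ^ d * f d))
          ≈⟨ solve 7 (λ C K D B F A G → C :* (K :* D) :* ((B :* F) :* (A :* G)) := C :* B :* A :* ((F :* K) :* (G :* D))) ≈-refl
               (φ (n C k)) (φ (k !)) (φ (d !)) (b ^ k) (f k) (a ^ d) (f d) ⟩
        φ (n C k) * b ^ k * a ^ d * ((f k * φ (k !)) * (f d * φ (d !)))
          ≈⟨ *-congˡ (≈-trans (*-cong (f-inverse k) (f-inverse d)) (*-identityˡ 1#)) ⟩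
        φ (n C k) * b ^ k * a ^ d * 1#
          ≈⟨ *-identityʳ _ ⟩
        φ (n C k) * b ^ k * a ^ d ∎
        where
        n : ℕ
        n = k ℕ.+ d

      -- The `t`-th term of the binomial expansion of (1 - z b)^(t+s) becomes the summand with index
      -- i = k + t; `C-C` matches the coefficients.
      term≈ : ∀ k t s → φ ((k ℕ.+ (t ℕ.+ s)) C k) * b ^ k *
                (((t ℕ.+ s) C t) · ((- (z * b)) ^ t * 1# ^ (t ℕ.+ s ∸ t))) ≈
              term k (k ℕ.+ (t ℕ.+ s)) (k ℕ.+ t)
      term≈ k t s = begin
        φ c₁ * b ^ k * (c₂ · ((- (z * b)) ^ t * 1# ^ (t ℕ.+ s ∸ t)))
          ≈⟨ *-congˡ (≈-trans (·≈φ* c₂ _) (*-congˡ (≈-trans (*-congˡ (1^n≈1 (t ℕ.+ s ∸ t))) (*-identityʳ _)))) ⟩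
        φ c₁ * b ^ k * (φ c₂ * (- (z * b)) ^ t)
          ≈⟨ *-congˡ (*-congˡ (≈-trans (^-congˡ t (≈-sym (≈-trans (*-congʳ ν≈-1) (-1*x≈-x (z * b)))))
               (≈-trans (^-distrib-* ν (z * b) t) (*-congˡ (≈-trans (^-distrib-* z b t) (*-congʳ (≈-sym (w≈z^ t)))))))) ⟩
        φ c₁ * b ^ k * (φ c₂ * (ν ^ t * (w t * b ^ t)))
          ≈⟨ solve 6 (λ C B D m W E → C :* B :* (D :* (m :* (W :* E))) := (C :* D) :* m :* W :* (B :* E)) ≈-refl
               (φ c₁) (b ^ k) (φ c₂) (ν ^ t) (w t) (b ^ t) ⟩
        (φ c₁ * φ c₂) * ν ^ t * w t * (b ^ k * b ^ t)
          ≈⟨ *-cong (*-congʳ (*-congʳ coefficient)) (≈-sym (^-homo-* b k t)) ⟩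
        (φ c₃ * φ c₄) * ν ^ t * w t * b ^ (k ℕ.+ t)
          ≡⟨ cong (λ e → (φ c₃ * φ c₄) * ν ^ e * w e * b ^ (k ℕ.+ t)) (ℕ.m+n∸m≡n k t) ⟨
        (φ c₃ * φ c₄) * ν ^ (k ℕ.+ t ∸ k) * w (k ℕ.+ t ∸ k) * b ^ (k ℕ.+ t) ∎
        where
        c₁ c₂ c₃ c₄ : ℕ
        c₁ = (k ℕ.+ (t ℕ.+ s)) C k
        c₂ = (t ℕ.+ s) C t
        c₃ = (k ℕ.+ t) C k
        c₄ = (k ℕ.+ (t ℕ.+ s)) C (k ℕ.+ t)
        coefficient : φ c₁ * φ c₂ ≈ φ c₃ * φ c₄
        coefficient = ≈-trans (≈-sym (φ-* c₁ c₂))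
          (≈-trans (≈-reflexive (cong φ (sym (BinomialCoefficients.C-C k t s)))) (φ-* c₃ c₄))

      lhs≈rhs : ∀ k n → lhs k n ≈ rhs k n
      lhs≈rhs k n with ℕ.≤-<-connex k n
      ... | inj₂ n<k = begin
        lhs k n
          ≈⟨ *-congˡ (*-congˡ (sum-δ-≥ n<k (λ i → e (n ∸ i)))) ⟩
        φ (n !) * ((b ^ k * f k) * 0#)
          ≈⟨ ≈-trans (*-congˡ (zeroʳ _)) (zeroʳ _) ⟩
        0#
          -- For n < k the length `suc n ∸ k` is 0, so the sum is empty.
          ≡⟨ cong (λ m → sum {m} (λ t → term k n (k ℕ.+ toℕ t))) (ℕ.m≤n⇒m∸n≡0 n<k) ⟨
        rhs k n ∎
      ... | inj₁ k≤n with ℕ.m≤n⇒∃[o]m+o≡n k≤n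
      ...   | d , refl = begin
        lhs k (k ℕ.+ d)
          ≈⟨ closedForm k d ⟩
        φ ((k ℕ.+ d) C k) * b ^ k * a ^ d
          -- The summands are swapped so that the binomial index counts the powers of - (z b).
          ≈⟨ *-congˡ (≈-trans (^-congˡ d (≈-trans a≈1-zb (+-comm 1# _))) (binomialTheorem d (- (z * b)) 1#)) ⟩
        φ ((k ℕ.+ d) C k) * b ^ k * sum {suc d} (λ t → (d C toℕ t) · ((- (z * b)) ^ toℕ t * 1# ^ (d ∸ toℕ t)))
          ≈⟨ *-distribˡ-sum {suc d} _ (λ t → (d C toℕ t) · ((- (z * b)) ^ toℕ t * 1# ^ (d ∸ toℕ t))) ⟩
        sum {suc d} (λ t → φ ((k ℕ.+ d) C k) * b ^ k * ((d C toℕ t) · ((- (z * b)) ^ toℕ t * 1# ^ (d ∸ toℕ t))))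
          ≈⟨ sum-cong-≋ {suc d} (λ t → term≈′ (toℕ t) (ℕ.≤-pred (Fin.toℕ<n t))) ⟩
        sum {suc d} (λ t → term k (k ℕ.+ d) (k ℕ.+ toℕ t))
          ≡⟨ cong (λ m → sum {m} (λ t → term k (k ℕ.+ d) (k ℕ.+ toℕ t))) (trans (ℕ.+-∸-assoc 1 (ℕ.m≤m+n k d)) (cong suc (ℕ.m+n∸m≡n k d))) ⟨
        rhs k (k ℕ.+ d) ∎
        where
        term≈′ : ∀ t → t ℕ.≤ d → φ ((k ℕ.+ d) C k) * b ^ k * ((d C t) · ((- (z * b)) ^ t * 1# ^ (d ∸ t))) ≈
                 term k (k ℕ.+ d) (k ℕ.+ t)
        term≈′ t t≤d with ℕ.m≤n⇒∃[o]m+o≡n t≤d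
        ... | s , refl = term≈ k t s

      -- `d` and `s` are the coefficients of t^k and of the convolution as formed outside this
      -- module, given up to `≈` like `w`, `ν` and `e`.
      expansion : ∀ k n (d : ℕ → Carrier) → (∀ i → d i ≈ δ k i) → ∀ s → s ≈ ∑ 0 n (λ i → d i * e (n ∸ i)) →
        φ (n !) * ((b ^ k * f k) * s) ≈ ∑ k n (term k n)
      expansion k n d d≈δ s s≈ = ≈-trans
        (*-congˡ (*-congˡ (≈-trans s≈ (sum-cong-≋ {suc n} (λ i → *-congʳ {e (n ∸ toℕ i)} (d≈δ (toℕ i)))))))
        (lhs≈rhs k n)

-- Exponential and logarithm of reals.

open import Data.Rational as ℚ using (ℚ; 0ℚ; 1ℚ; ∣_∣)
import Data.Rational.Properties as ℚ
open import Data.Rational.Solver using (module +-*-Solver)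
open import Defs
open RationalLemmas using (∣-∣-sym; ≤⇒0≤-; ι; ι-suc; 1/!_; 1/!-*-!; eval)
open +-*-Solver using (solve; con; _:+_; _:*_; _:-_; _:=_)

≈-refl : ∀ {x} → x ≈ x
≈-refl {x} = pointwise {x} {x} (λ _ → refl)

-- The bound chosen inside `exp` enters only the Cauchy proof, so the sequence of `exp x` is
-- determined by that of `x`. Exponents are therefore rewritten termwise by rational identities.
exp-pointwise : ∀ {x y} → (∀ n → seq x n ≡ seq y n) → exp x ≈ exp y
exp-pointwise {x} {y} eq = pointwise {exp x} {exp y} (λ n → cong (eval 1/!_ n) (eq n))

exp-0 : exp 0ℝ ≈ 1ℝ
-- The rank is 1 because the empty partial sum is 0.
exp-0 {ε} 0<ε = 1 , λ { {suc n} _ →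
  subst (ℚ._< ε) (sym (cong (λ z → ∣ z ℚ.- 1ℚ ∣) (RationalSeries.eval-exp-0 n))) 0<ε }

exp-+ : ∀ x y → exp (x + y) ≈ exp x * exp y
exp-+ x y {ε} 0<ε =
  let (K , 0≤K , A , x≤K) = bounded x
      (M , 0≤M , B , y≤M) = bounded y
      (N , close)         = RationalSeries.exp-+-close (ℚ.+-mono-≤ 0≤K 0≤M) 0<ε
  in (A ℕ.⊔ B) ℕ.⊔ N , λ {n} ≤n →
    subst (ℚ._< ε) (∣-∣-sym (seq (exp x * exp y) n) (seq (exp (x + y)) n))
      (close (⊔ʳ {A ℕ.⊔ B} ≤n) (ℚ.+-mono-≤ (x≤K (⊔ˡ {A} (⊔ˡ {A ℕ.⊔ B} ≤n))) (y≤M (⊔ʳ {A} (⊔ˡ {A ℕ.⊔ B} ≤n)))))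

-- The n-th approximation of the left side is the n-th partial sum of exp at minus that of
-- Mercator's series at u = 1 - q_n. Eventually 0 <= u <= 1 - δ, as `exp-log-close` demands.
exp-log : ∀ q 0<q q<1 → exp (log q 0<q q<1) ≈ q
exp-log q (δ , 0<δ , N , above) (δ′ , 0<δ′ , M , below) {ε} 0<ε =
  let (A , close) = RationalSeries.exp-log-close 0≤r r<1 0<ε in
  (N ℕ.⊔ M) ℕ.⊔ A , λ {n} ≤n →
    subst (λ p → ∣ seq (exp (log q (δ , 0<δ , N , above) (δ′ , 0<δ′ , M , below))) n ℚ.- p ∣ ℚ.< ε)
      (solve 1 (λ p → con 1ℚ :- (con 1ℚ :- p) := p) refl (seq q n))
      (close (⊔ʳ {N ℕ.⊔ M} ≤n) (0≤u (⊔ˡ {N ℕ.⊔ M} ≤n)) (u≤r (⊔ˡ {N ℕ.⊔ M} ≤n)))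
  where
  r : ℚ
  r = 1ℚ ℚ.- δ
  0≤u : ∀ {n} → N ℕ.⊔ M ℕ.≤ n → 0ℚ ℚ.≤ 1ℚ ℚ.- seq q n
  0≤u {n} ≤n = ≤⇒0≤- (ℚ.≤-trans (ℚ.≤-trans (ℚ.≤-reflexive (sym (ℚ.+-identityʳ (seq q n))))
                 (ℚ.+-monoʳ-≤ (seq q n) (ℚ.<⇒≤ 0<δ′))) (below (⊔ʳ {N} ≤n)))
  u≤r : ∀ {n} → N ℕ.⊔ M ℕ.≤ n → 1ℚ ℚ.- seq q n ℚ.≤ r
  u≤r {n} ≤n = ℚ.+-monoʳ-≤ 1ℚ (ℚ.neg-antimono-≤ (0<⇒≥δ {q} {δ} {n} (above (⊔ˡ {N} ≤n))))
  0≤r : 0ℚ ℚ.≤ r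
  0≤r = ℚ.≤-trans (0≤u ℕ.≤-refl) (u≤r ℕ.≤-refl)
  r<1 : r ℚ.< 1ℚ
  r<1 = ℚ.+-monoʳ-< 1ℚ (ℚ.neg-antimono-< 0<δ)

-- With l = log q this reads q^(y j) = (q^y)^j; each successor splits off one factor by `exp-+`.
exp-*-fromℕ : ∀ y l j → exp (y * fromℕ j * l) ≈ exp (y * l) ^ j
exp-*-fromℕ y l zero    = ≈-trans {exp (y * fromℕ 0 * l)} {exp 0ℝ} {1ℝ}
  (exp-pointwise {y * fromℕ 0 * l} {0ℝ} (λ n → solve 2 (λ y l → y :* con 0ℚ :* l := con 0ℚ) refl (seq y n) (seq l n)))
  exp-0
exp-*-fromℕ y l (suc j) =
  ≈-trans {exp (y * fromℕ (suc j) * l)} {exp (y * l + y * fromℕ j * l)} {exp (y * l) ^ suc j}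
    (exp-pointwise {y * fromℕ (suc j) * l} {y * l + y * fromℕ j * l} (λ n → trans
      (cong (λ i → seq y n ℚ.* i ℚ.* seq l n) (ι-suc j))
      (solve 3 (λ y i l → y :* (i :+ con 1ℚ) :* l := y :* l :+ y :* i :* l) refl (seq y n) (ι j) (seq l n))))
    (≈-trans {exp (y * l + y * fromℕ j * l)} {exp (y * l) * exp (y * fromℕ j * l)} {exp (y * l) ^ suc j}
      (exp-+ (y * l) (y * fromℕ j * l))
      (*-cong {exp (y * l)} {exp (y * l)} {exp (y * fromℕ j * l)} {exp (y * l) ^ j}
        (≈-refl {exp (y * l)}) (exp-*-fromℕ y l j)))

-- The relation between the q-numbers of x and 1 - x.

module _ (q : ℝ) (0<q : 0ℝ < q) (q<1 : q < 1ℝ) where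
  open qCalculus q 0<q q<1

  q^1-x*q^x : ∀ x → q^ (1ℝ - x) * q^ x ≈ q
  q^1-x*q^x x = ≈-trans {q^ (1ℝ - x) * q^ x} {exp ((1ℝ - x) * l + x * l)} {q}
    (≈-sym {exp ((1ℝ - x) * l + x * l)} {q^ (1ℝ - x) * q^ x} (exp-+ ((1ℝ - x) * l) (x * l)))
    (≈-trans {exp ((1ℝ - x) * l + x * l)} {exp l} {q}
      (exp-pointwise {(1ℝ - x) * l + x * l} {l} (λ n →
        solve 2 (λ x l → (con 1ℚ :- x) :* l :+ x :* l := l) refl (seq x n) (seq l n)))
      (exp-log q 0<q q<1))
    where
    l : ℝ
    l = log q 0<q q<1

  -- With z = q^(1-x) and p = q^x, one has 1 - z = (1 - z p) - z (1 - p). Dividing by 1 - q turns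
  -- the first difference into 1, since z p = q.
  [1-x]q : ∀ x → [ 1ℝ - x ]q ≈ 1ℝ - q^ (1ℝ - x) * [ x ]q
  [1-x]q x = begin
    (1ℝ - z) * ρ
      ≈⟨ pointwise {(1ℝ - z) * ρ} {ρ * (1ℝ - z * p) - z * [ x ]q} (λ n →
           solve 3 (λ z p r → (con 1ℚ :- z) :* r := r :* (con 1ℚ :- z :* p) :- z :* ((con 1ℚ :- p) :* r)) refl
             (seq z n) (seq p n) (seq ρ n)) ⟩
    ρ * (1ℝ - z * p) - z * [ x ]q
      ≈⟨ -zb-cong {ρ * (1ℝ - z * p)} {ρ * (1ℝ - q)}
           (*-cong {ρ} {ρ} {1ℝ - z * p} {1ℝ - q} (≈-refl {ρ})
             (+-cong {1ℝ} {1ℝ} { - (z * p)} { - q} (≈-refl {1ℝ}) (neg-cong {z * p} {q} (q^1-x*q^x x)))) ⟩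
    ρ * (1ℝ - q) - z * [ x ]q
      ≈⟨ -zb-cong {ρ * (1ℝ - q)} {1ℝ} (recip-inverseˡ (1ℝ - q) 0<1-q) ⟩
    1ℝ - z * [ x ]q ∎
    where
    open import Relation.Binary.Reasoning.Setoid (CommutativeRing.setoid ℝ-commutativeRing)
    z p ρ : ℝ
    z = q^ (1ℝ - x)
    p = q^ x
    ρ = recip (1ℝ - q) 0<1-q
    -zb-cong : ∀ {a b} → a ≈ b → a - z * [ x ]q ≈ b - z * [ x ]q
    -zb-cong {a} {b} a≈b = +-cong {a} {b} { - (z * [ x ]q)} { - (z * [ x ]q)} a≈b (≈-refl { - (z * [ x ]q)})

-- Specialisation to the reals.

fromℕ-suc : ∀ n → fromℕ (suc n) ≈ fromℕ n + 1ℝ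
fromℕ-suc n = pointwise {fromℕ (suc n)} {fromℕ n + 1ℝ} (λ _ → ι-suc n)

1/!-inverse : ∀ n → fromℚ (1/! n) * fromℕ (n !) ≈ 1ℝ
1/!-inverse n = pointwise {fromℚ (1/! n) * fromℕ (n !)} {1ℝ} (λ _ → 1/!-*-! n)

sum-pointwise : ∀ {m} {u v : Fin m → ℝ} → (∀ j l → seq (u j) l ≡ seq (v j) l) → ∀ l → seq (sum u) l ≡ seq (sum v) l
sum-pointwise {zero}  eq l = refl
sum-pointwise {suc m} eq l = cong₂ ℚ._+_ (eq Fin.zero l) (sum-pointwise {m} (λ j → eq (Fin.suc j)) l)

-- Identifying the summands by conversion is infeasible, since that would also compare their cauchy fields.
≈-sum : ∀ x {m} {u v : Fin m → ℝ} → x ≈ sum u → (∀ j l → seq (u j) l ≡ seq (v j) l) → x ≈ sum v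
≈-sum x {m} {u} {v} x≈u eq = ≈-trans {x} {sum u} {sum v} x≈u (pointwise {sum u} {sum v} (sum-pointwise eq))

∑-pointwise : {f g : ℕ → ℝ} → (∀ i l → seq (f i) l ≡ seq (g i) l) → (k n : ℕ) →
  ∑[ k ⋯ n ] f ≈ BernsteinExpansion.∑ ℝ-commutativeRing k n g
∑-pointwise {f} {g} eq k n = ≈-sum (∑[ k ⋯ n ] f) {suc n ∸ k} {λ j → f (k ℕ.+ toℕ j)} {λ j → g (k ℕ.+ toℕ j)}
  (≈-refl {∑[ k ⋯ n ] f}) (λ j → eq (k ℕ.+ toℕ j))

⊛≈∑ : (f g : ℕ → ℝ) (n : ℕ) →
  (f ⊛ g) n ≈ BernsteinExpansion.∑ ℝ-commutativeRing 0 n (λ i → CommutativeRing._*_ ℝ-commutativeRing (f i) (g (n ∸ i)))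
⊛≈∑ f g n = ∑-pointwise {λ i → f i * g (n ∸ i)} {λ i → CommutativeRing._*_ ℝ-commutativeRing (f i) (g (n ∸ i))}
  (λ i l → refl) 0 n

-- `a`, `b`, `z` and `w j` stand for [1-x], [x], q^(1-x) and q^((1-x)j); as variables they keep the
-- exponentials folded when summands are compared.
bernstein-expansion : (k n : ℕ) (a b z : ℝ) → a ≈ 1ℝ - z * b → (w : ℕ → ℝ) → (∀ j → w j ≈ z ^ j) →
  fromℕ (n !) * ((b ^ k * fromℚ (1/! k)) • (t^ k ⊛ exp[ a t])) n ≈ ∑[ k ⋯ n ] (λ i →
    fromℕ (i C k) * fromℕ (n C i) * (- 1ℝ) ^ (i ∸ k) * w (i ∸ k) * b ^ i)
bernstein-expansion k n a b z a≈1-zb w w≈z^ =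
  ≈-sum (fromℕ (n !) * ((b ^ k * fromℚ (1/! k)) • (t^ k ⊛ exp[ a t])) n) {suc n ∸ k}
    (BernsteinExpansion.expansion ℝ-commutativeRing
      fromℕ (≈-refl {0ℝ}) fromℕ-suc (λ n → fromℚ (1/! n)) 1/!-inverse
      a b z a≈1-zb w w≈z^ (- 1ℝ) (≈-refl { - 1ℝ}) exp[ a t] (λ j → ≈-refl {exp[ a t] j})
      k n (t^ k) (λ i → ≈-refl {(t^ k) i}) ((t^ k ⊛ exp[ a t]) n) (⊛≈∑ (t^ k) exp[ a t] n))
    (λ j l → refl)

theorem6 : (q : ℝ) (0<q : 0ℝ < q) (q<1 : q < 1ℝ) (k n : ℕ) (x : ℝ) → 0ℝ ≤ x → x ≤ 1ℝ →
    let open qCalculus q 0<q q<1 in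
    B k n x ≈ ∑[ k ⋯ n ] (λ i →
    fromℕ (i C k) * fromℕ (n C i) * (- 1ℝ) ^ (i ∸ k) * q^ ((1ℝ - x) * fromℕ (i ∸ k)) * [ x ]q ^ i)
theorem6 q 0<q q<1 k n x _ _ =
  ≈-sum (qCalculus.B q 0<q q<1 k n x) {suc n ∸ k}
    (bernstein-expansion k n
      (qCalculus.[_]q q 0<q q<1 (1ℝ - x)) (qCalculus.[_]q q 0<q q<1 x) (qCalculus.q^_ q 0<q q<1 (1ℝ - x))
      ([1-x]q q 0<q q<1 x)
      (λ j → qCalculus.q^_ q 0<q q<1 ((1ℝ - x) * fromℕ j)) (exp-*-fromℕ (1ℝ - x) (log q 0<q q<1)))
    (λ j l → refl)
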